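{- Let $R$ be a finite local Frobenius ring which is not a field, of odd characteristic, in which $3$ is a unit, and fix a primitive additive character $\psi$ of $R$. Then for every non-primitive multiplicative character $\tau$ of $R$, $$\sum_{a\in R^\times}K_\tau(a)^3=0.$$
   Context: All rings are finite and commutative with identity; $R^\times$ is the unit group; $M$ is the maximal ideal of the local ring $R$. An additive character $(R,+)\to\mathbb{C}^*$ is primitive if the only ideal on which it is identically $1$ is $(0)$; $R$ is Frobenius if such a character exists. A multiplicative character is a homomorphism $R^\times\to\mathbb{C}^*$; its conductor is $R$ if it is trivial, and otherwise the largest ideal $I\subseteq M$ such that it is identically $1$ on $1+I$; it is primitive if its conductor is $(0)$. $K_\tau(a)=\sum_{u\in R^\times}\tau(u)\psi(u+au^{ -1})$. Odd characteristic means $R/M$ has odd characteristic. -}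

module Defs where

open import Algebra.Bundles
open import Algebra.Definitions using (Invertible)
open import Algebra.Morphism.Bundles using (GroupHomomorphism)
import Algebra.Consequences.Setoid as Consequences
import Algebra.Construct.DirectProduct as DirectProduct
import Algebra.Definitions.RawMonoid as RawMonoidDefs
import Algebra.Definitions.RawSemiring as RawSemiringDefs
import Algebra.Properties.AbelianGroup as AbelianGroupProperties
import Algebra.Properties.CommutativeSemigroup as CommutativeSemigroupProperties
import Algebra.Properties.Ring as RingProperties
open import Data.Fin.Base using (Fin)
import Data.Fin.Properties as Fin
open import Data.Nat.Base as ℕ using (ℕ)
import Data.Nat.Divisibility as ℕ
import Data.Nat.Properties as ℕ
open import Data.Product.Base using (Σ; ∃-syntax; _×_; _,_; proj₁; proj₂)
open import Data.Product.Relation.Binary.Pointwise.NonDependent using (Pointwise; ×-setoid)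
open import Data.Rational.Base using (ℚ; 0ℚ; 1ℚ; ½; ∣_∣; _<_; _≤_; 1/_; Positive; NonNegative; NonZero)
  renaming (_+_ to _+ℚ_; _*_ to _*ℚ_; _-_ to _-ℚ_; -_ to -ℚ_)
import Data.Rational.Base as ℚ
import Data.Rational.Properties as ℚ
open import Data.Rational.Solver using (module +-*-Solver)
open import Data.Sum.Base using (_⊎_)
open import Data.Unit.Polymorphic.Base using (⊤; tt)
open import Function.Bundles using (Inverse; _⇔_)
open import Level using (0ℓ; _⊔_; Lift; lift) renaming (suc to lsuc)
open import Relation.Binary.Definitions using (Decidable; _Respects_)
open import Relation.Binary.PropositionalEquality
  using (_≡_; refl; sym; trans; cong; cong₂; subst)
import Relation.Binary.PropositionalEquality as ≡
import Relation.Binary.Reasoning.Setoid as SetoidReasoning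
open import Relation.Binary.Structures using (IsEquivalence)
open import Relation.Nullary using (¬_; Dec; yes; no)
open import Relation.Nullary.Decidable using (map′; _×-dec_)
open import Relation.Unary using (Pred; _∈_; _⊆_; _≐_)

-- f m n → 0 as both m → ∞ and n → ∞
Vanishing : (ℕ → ℕ → ℚ) → Set
Vanishing f = ∀ ε → 0ℚ < ε → ∃[ N ] ∀ m n → N ℕ.≤ m → N ℕ.≤ n → ∣ f m n ∣ < ε

Bounded : (ℕ → ℕ → ℚ) → Set
Bounded b = ∃[ B ] (0ℚ < B × ∃[ N ] ∀ m n → N ℕ.≤ m → N ℕ.≤ n → ∣ b m n ∣ ≤ B)

abstract

  half-pos : ∀ ε → 0ℚ < ε → 0ℚ < ½ *ℚ ε
  half-pos ε 0<ε = subst (_< ½ *ℚ ε) (ℚ.*-zeroʳ ½) (ℚ.*-monoʳ-<-pos ½ 0<ε)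

  half+half : ∀ ε → ½ *ℚ ε +ℚ ½ *ℚ ε ≡ ε
  half+half ε = trans (sym (ℚ.*-distribʳ-+ ε ½ ½)) (ℚ.*-identityˡ ε)

  vanish-resp : ∀ {f g} → (∀ m n → f m n ≡ g m n) → Vanishing f → Vanishing g
  vanish-resp eq vf ε 0<ε with vf ε 0<ε
  ... | N , p = N , λ m n N≤m N≤n → subst (λ q → ∣ q ∣ < ε) (eq m n) (p m n N≤m N≤n)

  vanish-0 : ∀ {f} → (∀ m n → f m n ≡ 0ℚ) → Vanishing f
  vanish-0 eq ε 0<ε = 0 , λ m n _ _ → subst (λ q → ∣ q ∣ < ε) (sym (eq m n)) 0<ε

  vanish-+ : ∀ {f g} → Vanishing f → Vanishing g → Vanishing (λ m n → f m n +ℚ g m n)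
  vanish-+ {f} {g} vf vg ε 0<ε
    with vf (½ *ℚ ε) (half-pos ε 0<ε) | vg (½ *ℚ ε) (half-pos ε 0<ε)
  ... | N , p | N′ , p′ = N ℕ.⊔ N′ , λ m n N≤m N≤n →
    ℚ.≤-<-trans (ℚ.∣p+q∣≤∣p∣+∣q∣ (f m n) (g m n))
      (subst (∣ f m n ∣ +ℚ ∣ g m n ∣ <_) (half+half ε)
        (ℚ.+-mono-<
          (p m n (ℕ.m⊔n≤o⇒m≤o N N′ N≤m) (ℕ.m⊔n≤o⇒m≤o N N′ N≤n))
          (p′ m n (ℕ.m⊔n≤o⇒n≤o N N′ N≤m) (ℕ.m⊔n≤o⇒n≤o N N′ N≤n))))

  vanish-neg : ∀ {f} → Vanishing f → Vanishing (λ m n → -ℚ f m n)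
  vanish-neg {f} vf ε 0<ε with vf ε 0<ε
  ... | N , p = N , λ m n N≤m N≤n →
    subst (_< ε) (sym (ℚ.∣-p∣≡∣p∣ (f m n))) (p m n N≤m N≤n)

  vanish-* : ∀ {b f} → Bounded b → Vanishing f → Vanishing (λ m n → b m n *ℚ f m n)
  vanish-* {b} {f} (B , 0<B , N , bd) vf ε 0<ε = N ℕ.⊔ N′ , bound
    where
    instance
      posB : Positive B
      posB = ℚ.positive 0<B
      nzB : NonZero B
      nzB = ℚ.pos⇒nonZero B
      posInv : Positive (1/ B)
      posInv = ℚ.1/pos⇒pos B
      nonNegB : NonNegative B
      nonNegB = ℚ.pos⇒nonNeg B

    δ : ℚ
    δ = (1/ B) *ℚ ε

    0<δ : 0ℚ < δ
    0<δ = subst (_< δ) (ℚ.*-zeroʳ (1/ B)) (ℚ.*-monoʳ-<-pos (1/ B) 0<ε)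

    B*δ≡ε : B *ℚ δ ≡ ε
    B*δ≡ε = trans (sym (ℚ.*-assoc B (1/ B) ε))
              (trans (cong (_*ℚ ε) (ℚ.*-inverseʳ B)) (ℚ.*-identityˡ ε))

    N′ : ℕ
    N′ = proj₁ (vf δ 0<δ)

    bound : ∀ m n → N ℕ.⊔ N′ ℕ.≤ m → N ℕ.⊔ N′ ℕ.≤ n → ∣ b m n *ℚ f m n ∣ < ε
    bound m n N≤m N≤n = ℚ.≤-<-trans ≤B*f (subst (B *ℚ ∣ f m n ∣ <_) B*δ≡ε B*f<B*δ)
      where
      instance
        nonNegf : NonNegative ∣ f m n ∣
        nonNegf = ℚ.∣-∣-nonNeg (f m n)

      ≤B*f : ∣ b m n *ℚ f m n ∣ ≤ B *ℚ ∣ f m n ∣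
      ≤B*f = subst (_≤ B *ℚ ∣ f m n ∣) (sym (ℚ.∣p*q∣≡∣p∣*∣q∣ (b m n) (f m n)))
        (ℚ.*-monoʳ-≤-nonNeg ∣ f m n ∣
          (bd m n (ℕ.m⊔n≤o⇒m≤o N N′ N≤m) (ℕ.m⊔n≤o⇒m≤o N N′ N≤n)))

      B*f<B*δ : B *ℚ ∣ f m n ∣ < B *ℚ δ
      B*f<B*δ = ℚ.*-monoʳ-<-pos B
        (proj₂ (vf δ 0<δ) m n (ℕ.m⊔n≤o⇒n≤o N N′ N≤m) (ℕ.m⊔n≤o⇒n≤o N N′ N≤n))

-- Cauchy sequences of rationals; equality is _≈ℝ_ below
record ℝ : Set where
  constructor mkℝ
  field
    seq    : ℕ → ℚ
    cauchy : Vanishing (λ m n → seq m -ℚ seq n)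

open ℝ

infix 4 _≈ℝ_
_≈ℝ_ : ℝ → ℝ → Set
x ≈ℝ y = Vanishing (λ n _ → seq x n -ℚ seq y n)

open +-*-Solver using (solve; _:=_; _:+_; _:*_; _:-_; :-_)

abstract

  0<1 : 0ℚ < 1ℚ
  0<1 = ℚ.positive⁻¹ 1ℚ

  add-subtract : ∀ a b → (a -ℚ b) +ℚ b ≡ a
  add-subtract = solve 2 (λ a b → (a :- b) :+ b := a) refl

  bound-near : ∀ a b → ∣ a -ℚ b ∣ < 1ℚ → ∣ a ∣ ≤ 1ℚ +ℚ ∣ b ∣
  bound-near a b near = subst (λ q → ∣ q ∣ ≤ 1ℚ +ℚ ∣ b ∣) (add-subtract a b)
    (ℚ.≤-trans (ℚ.∣p+q∣≤∣p∣+∣q∣ (a -ℚ b) b) (ℚ.+-monoˡ-≤ ∣ b ∣ (ℚ.<⇒≤ near)))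

  0<1+∣_∣ : ∀ b → 0ℚ < 1ℚ +ℚ ∣ b ∣
  0<1+∣ b ∣ = ℚ.<-≤-trans 0<1
    (subst (_≤ 1ℚ +ℚ ∣ b ∣) (ℚ.+-identityʳ 1ℚ) (ℚ.+-monoʳ-≤ 1ℚ (ℚ.0≤∣p∣ b)))

  bounded : ∀ x → ∃[ B ] (0ℚ < B × ∃[ N ] ∀ n → N ℕ.≤ n → ∣ seq x n ∣ ≤ B)
  bounded x = 1ℚ +ℚ ∣ seq x N ∣ , 0<1+∣ seq x N ∣ , N , λ n N≤n →
    bound-near (seq x n) (seq x N) (proj₂ (cauchy x 1ℚ 0<1) n N N≤n ℕ.≤-refl)
    where
    N : ℕ
    N = proj₁ (cauchy x 1ℚ 0<1)

  boundedˡ : ∀ x → Bounded (λ m _ → seq x m)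
  boundedˡ x = let (B , 0<B , N , p) = bounded x in B , 0<B , N , λ m _ N≤m _ → p m N≤m

  boundedʳ : ∀ x → Bounded (λ _ n → seq x n)
  boundedʳ x = let (B , 0<B , N , p) = bounded x in B , 0<B , N , λ _ n _ N≤n → p n N≤n

  pointwise : ∀ x y → (∀ n → seq x n ≡ seq y n) → x ≈ℝ y
  pointwise x y eq = vanish-0 λ n _ →
    trans (cong (_-ℚ seq y n) (eq n)) (ℚ.+-inverseʳ (seq y n))

  ≈ℝ-isEquivalence : IsEquivalence _≈ℝ_
  ≈ℝ-isEquivalence = record
    { refl  = λ {x} → pointwise x x (λ _ → refl)
    ; sym   = λ {x} {y} x≈y → vanish-resp (λ n _ → swap (seq x n) (seq y n)) (vanish-neg x≈y)
    ; trans = λ {x} {y} {z} x≈y y≈z →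
        vanish-resp (λ n _ → telescope (seq x n) (seq y n) (seq z n)) (vanish-+ x≈y y≈z)
    }
    where
    swap : ∀ a b → -ℚ (a -ℚ b) ≡ b -ℚ a
    swap = solve 2 (λ a b → :- (a :- b) := b :- a) refl
    telescope : ∀ a b c → (a -ℚ b) +ℚ (b -ℚ c) ≡ a -ℚ c
    telescope = solve 3 (λ a b c → (a :- b) :+ (b :- c) := a :- c) refl

  +-difference : ∀ a b c d → (a -ℚ c) +ℚ (b -ℚ d) ≡ (a +ℚ b) -ℚ (c +ℚ d)
  +-difference = solve 4 (λ a b c d → (a :- c) :+ (b :- d) := (a :+ b) :- (c :+ d)) refl

  *-difference : ∀ a b c d → a *ℚ (b -ℚ d) +ℚ d *ℚ (a -ℚ c) ≡ (a *ℚ b) -ℚ (c *ℚ d)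
  *-difference = solve 4 (λ a b c d → a :* (b :- d) :+ d :* (a :- c) := (a :* b) :- (c :* d)) refl

  neg-difference : ∀ a b → -ℚ (a -ℚ b) ≡ (-ℚ a) -ℚ (-ℚ b)
  neg-difference = solve 2 (λ a b → :- (a :- b) := (:- a) :- (:- b)) refl

infixl 6 _+ℝ_
_+ℝ_ : ℝ → ℝ → ℝ
x +ℝ y = mkℝ (λ n → seq x n +ℚ seq y n)
  (vanish-resp (λ m n → +-difference (seq x m) (seq y m) (seq x n) (seq y n))
    (vanish-+ (cauchy x) (cauchy y)))

infixl 7 _*ℝ_
_*ℝ_ : ℝ → ℝ → ℝ
x *ℝ y = mkℝ (λ n → seq x n *ℚ seq y n)
  (vanish-resp (λ m n → *-difference (seq x m) (seq y m) (seq x n) (seq y n))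
    (vanish-+ (vanish-* (boundedˡ x) (cauchy y)) (vanish-* (boundedʳ y) (cauchy x))))

-ℝ_ : ℝ → ℝ
-ℝ x = mkℝ (λ n → -ℚ seq x n)
  (vanish-resp (λ m n → neg-difference (seq x m) (seq x n)) (vanish-neg (cauchy x)))

fromℚ : ℚ → ℝ
fromℚ q = mkℝ (λ _ → q) (vanish-0 (λ _ _ → ℚ.+-inverseʳ q))

ℝ-commutativeRing : CommutativeRing 0ℓ 0ℓ
ℝ-commutativeRing = record
  { Carrier = ℝ
  ; _≈_     = _≈ℝ_
  ; _+_     = _+ℝ_
  ; _*_     = _*ℝ_
  ; -_      = -ℝ_
  ; 0#      = fromℚ 0ℚ
  ; 1#      = fromℚ 1ℚ
  ; isCommutativeRing = record
    { isRing = record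
      { +-isAbelianGroup = record
        { isGroup = record
          { isMonoid = record
            { isSemigroup = record
              { isMagma = record
                { isEquivalence = ≈ℝ-isEquivalence
                ; ∙-cong = λ {x} {x′} {y} {y′} x≈x′ y≈y′ → vanish-resp
                    (λ n _ → +-difference (seq x n) (seq y n) (seq x′ n) (seq y′ n))
                    (vanish-+ x≈x′ y≈y′)
                }
              ; assoc = λ x y z → pointwise ((x +ℝ y) +ℝ z) (x +ℝ (y +ℝ z))
                  λ n → ℚ.+-assoc (seq x n) (seq y n) (seq z n)
              }
            ; identity = (λ x → pointwise (fromℚ 0ℚ +ℝ x) x λ n → ℚ.+-identityˡ (seq x n))
                       , (λ x → pointwise (x +ℝ fromℚ 0ℚ) x λ n → ℚ.+-identityʳ (seq x n))
            }
          ; inverse = (λ x → pointwise ((-ℝ x) +ℝ x) (fromℚ 0ℚ) λ n → ℚ.+-inverseˡ (seq x n))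
                    , (λ x → pointwise (x +ℝ (-ℝ x)) (fromℚ 0ℚ) λ n → ℚ.+-inverseʳ (seq x n))
          ; ⁻¹-cong = λ {x} {y} x≈y → vanish-resp
              (λ n _ → neg-difference (seq x n) (seq y n)) (vanish-neg x≈y)
          }
        ; comm = λ x y → pointwise (x +ℝ y) (y +ℝ x) λ n → ℚ.+-comm (seq x n) (seq y n)
        }
      ; *-cong = λ {x} {x′} {y} {y′} x≈x′ y≈y′ → vanish-resp
          (λ n _ → *-difference (seq x n) (seq y n) (seq x′ n) (seq y′ n))
          (vanish-+ (vanish-* (boundedˡ x) y≈y′) (vanish-* (boundedˡ y′) x≈x′))
      ; *-assoc = λ x y z → pointwise ((x *ℝ y) *ℝ z) (x *ℝ (y *ℝ z))
          λ n → ℚ.*-assoc (seq x n) (seq y n) (seq z n)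
      ; *-identity = (λ x → pointwise (fromℚ 1ℚ *ℝ x) x λ n → ℚ.*-identityˡ (seq x n))
                   , (λ x → pointwise (x *ℝ fromℚ 1ℚ) x λ n → ℚ.*-identityʳ (seq x n))
      ; distrib = (λ x y z → pointwise (x *ℝ (y +ℝ z)) (x *ℝ y +ℝ x *ℝ z)
                    λ n → ℚ.*-distribˡ-+ (seq x n) (seq y n) (seq z n))
                , (λ x y z → pointwise ((y +ℝ z) *ℝ x) (y *ℝ x +ℝ z *ℝ x)
                    λ n → ℚ.*-distribʳ-+ (seq x n) (seq y n) (seq z n))
      }
    ; *-comm = λ x y → pointwise (x *ℝ y) (y *ℝ x) λ n → ℚ.*-comm (seq x n) (seq y n)
    }
  }

-- (a , b) stands for a + b i
ℂ : Set
ℂ = ℝ × ℝ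

infix 4 _≈ℂ_
_≈ℂ_ : ℂ → ℂ → Set
_≈ℂ_ = Pointwise _≈ℝ_ _≈ℝ_

infixl 6 _+ℂ_
_+ℂ_ : ℂ → ℂ → ℂ
(a , b) +ℂ (c , d) = a +ℝ c , b +ℝ d

infixl 7 _*ℂ_
_*ℂ_ : ℂ → ℂ → ℂ
(a , b) *ℂ (c , d) = a *ℝ c +ℝ (-ℝ (b *ℝ d)) , a *ℝ d +ℝ b *ℝ c

-ℂ_ : ℂ → ℂ
-ℂ (a , b) = -ℝ a , -ℝ b

0ℂ 1ℂ : ℂ
0ℂ = fromℚ 0ℚ , fromℚ 0ℚ
1ℂ = fromℚ 1ℚ , fromℚ 0ℚ

private
  module ℝR = CommutativeRing ℝ-commutativeRing

abstract

  *ℂ-cong : ∀ {x x′ y y′} → x ≈ℂ x′ → y ≈ℂ y′ → x *ℂ y ≈ℂ x′ *ℂ y′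
  *ℂ-cong {a , b} {a′ , b′} {c , d} {c′ , d′} (a≈ , b≈) (c≈ , d≈) =
    ℝR.+-cong {a *ℝ c} {a′ *ℝ c′} {(-ℝ (b *ℝ d))} {(-ℝ (b′ *ℝ d′))}
      (ℝR.*-cong {a} {a′} {c} {c′} a≈ c≈)
      (ℝR.-‿cong {b *ℝ d} {b′ *ℝ d′} (ℝR.*-cong {b} {b′} {d} {d′} b≈ d≈)) ,
    ℝR.+-cong {a *ℝ d} {a′ *ℝ d′} {b *ℝ c} {b′ *ℝ c′}
      (ℝR.*-cong {a} {a′} {d} {d′} a≈ d≈)
      (ℝR.*-cong {b} {b′} {c} {c′} b≈ c≈)

  *ℂ-comm : ∀ x y → x *ℂ y ≈ℂ y *ℂ x
  *ℂ-comm x@(a , b) y@(c , d) =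
    pointwise (proj₁ (x *ℂ y)) (proj₁ (y *ℂ x))
      (λ n → re (seq a n) (seq b n) (seq c n) (seq d n)) ,
    pointwise (proj₂ (x *ℂ y)) (proj₂ (y *ℂ x))
      (λ n → im (seq a n) (seq b n) (seq c n) (seq d n))
    where
    re : ∀ a b c d → a *ℚ c +ℚ (-ℚ (b *ℚ d)) ≡ c *ℚ a +ℚ (-ℚ (d *ℚ b))
    re = solve 4 (λ a b c d → a :* c :+ (:- (b :* d)) := c :* a :+ (:- (d :* b))) refl
    im : ∀ a b c d → a *ℚ d +ℚ b *ℚ c ≡ c *ℚ b +ℚ d *ℚ a
    im = solve 4 (λ a b c d → a :* d :+ b :* c := c :* b :+ d :* a) refl

  *ℂ-assoc : ∀ x y z → (x *ℂ y) *ℂ z ≈ℂ x *ℂ (y *ℂ z)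
  *ℂ-assoc x@(a , b) y@(c , d) z@(e , f) =
    pointwise (proj₁ ((x *ℂ y) *ℂ z)) (proj₁ (x *ℂ (y *ℂ z)))
      (λ n → re (seq a n) (seq b n) (seq c n) (seq d n) (seq e n) (seq f n)) ,
    pointwise (proj₂ ((x *ℂ y) *ℂ z)) (proj₂ (x *ℂ (y *ℂ z)))
      (λ n → im (seq a n) (seq b n) (seq c n) (seq d n) (seq e n) (seq f n))
    where
    re : ∀ a b c d e f →
         (a *ℚ c +ℚ (-ℚ (b *ℚ d))) *ℚ e +ℚ (-ℚ ((a *ℚ d +ℚ b *ℚ c) *ℚ f)) ≡
         a *ℚ (c *ℚ e +ℚ (-ℚ (d *ℚ f))) +ℚ (-ℚ (b *ℚ (c *ℚ f +ℚ d *ℚ e)))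
    re = solve 6 (λ a b c d e f →
         (a :* c :+ (:- (b :* d))) :* e :+ (:- ((a :* d :+ b :* c) :* f)) :=
         a :* (c :* e :+ (:- (d :* f))) :+ (:- (b :* (c :* f :+ d :* e)))) refl
    im : ∀ a b c d e f →
         (a *ℚ c +ℚ (-ℚ (b *ℚ d))) *ℚ f +ℚ (a *ℚ d +ℚ b *ℚ c) *ℚ e ≡
         a *ℚ (c *ℚ f +ℚ d *ℚ e) +ℚ b *ℚ (c *ℚ e +ℚ (-ℚ (d *ℚ f)))
    im = solve 6 (λ a b c d e f →
         (a :* c :+ (:- (b :* d))) :* f :+ (a :* d :+ b :* c) :* e :=
         a :* (c :* f :+ d :* e) :+ b :* (c :* e :+ (:- (d :* f)))) refl

  *ℂ-identityˡ : ∀ x → 1ℂ *ℂ x ≈ℂ x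
  *ℂ-identityˡ x@(a , b) =
    pointwise (proj₁ (1ℂ *ℂ x)) a (λ n → re (seq a n) (seq b n)) ,
    pointwise (proj₂ (1ℂ *ℂ x)) b (λ n → im (seq a n) (seq b n))
    where
    re : ∀ a b → 1ℚ *ℚ a +ℚ (-ℚ (0ℚ *ℚ b)) ≡ a
    re a b = trans (cong₂ (λ p q → p +ℚ (-ℚ q)) (ℚ.*-identityˡ a) (ℚ.*-zeroˡ b))
               (ℚ.+-identityʳ a)
    im : ∀ a b → 1ℚ *ℚ b +ℚ 0ℚ *ℚ a ≡ b
    im a b = trans (cong₂ _+ℚ_ (ℚ.*-identityˡ b) (ℚ.*-zeroˡ a)) (ℚ.+-identityʳ b)

  *ℂ-distribˡ : ∀ x y z → x *ℂ (y +ℂ z) ≈ℂ x *ℂ y +ℂ x *ℂ z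
  *ℂ-distribˡ x@(a , b) y@(c , d) z@(e , f) =
    pointwise (proj₁ (x *ℂ (y +ℂ z))) (proj₁ (x *ℂ y +ℂ x *ℂ z))
      (λ n → re (seq a n) (seq b n) (seq c n) (seq d n) (seq e n) (seq f n)) ,
    pointwise (proj₂ (x *ℂ (y +ℂ z))) (proj₂ (x *ℂ y +ℂ x *ℂ z))
      (λ n → im (seq a n) (seq b n) (seq c n) (seq d n) (seq e n) (seq f n))
    where
    re : ∀ a b c d e f →
         a *ℚ (c +ℚ e) +ℚ (-ℚ (b *ℚ (d +ℚ f))) ≡
         (a *ℚ c +ℚ (-ℚ (b *ℚ d))) +ℚ (a *ℚ e +ℚ (-ℚ (b *ℚ f)))
    re = solve 6 (λ a b c d e f →
         a :* (c :+ e) :+ (:- (b :* (d :+ f))) :=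
         (a :* c :+ (:- (b :* d))) :+ (a :* e :+ (:- (b :* f)))) refl
    im : ∀ a b c d e f →
         a *ℚ (d +ℚ f) +ℚ b *ℚ (c +ℚ e) ≡
         (a *ℚ d +ℚ b *ℚ c) +ℚ (a *ℚ f +ℚ b *ℚ e)
    im = solve 6 (λ a b c d e f →
         a :* (d :+ f) :+ b :* (c :+ e) :=
         (a :* d :+ b :* c) :+ (a :* f :+ b :* e)) refl

ℂ-commutativeRing : CommutativeRing 0ℓ 0ℓ
ℂ-commutativeRing = record
  { Carrier = ℂ
  ; _≈_     = _≈ℂ_
  ; _+_     = _+ℂ_
  ; _*_     = _*ℂ_
  ; -_      = -ℂ_
  ; 0#      = 0ℂ
  ; 1#      = 1ℂ
  ; isCommutativeRing = record
    { isRing = record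
      { +-isAbelianGroup = AbelianGroup.isAbelianGroup
          (DirectProduct.abelianGroup ℝR.+-abelianGroup ℝR.+-abelianGroup)
      ; *-cong     = λ {x} {x′} {y} {y′} → *ℂ-cong {x} {x′} {y} {y′}
      ; *-assoc    = *ℂ-assoc
      ; *-identity = Consequences.comm∧idˡ⇒id (×-setoid ℝR.setoid ℝR.setoid)
                       {_∙_ = _*ℂ_} *ℂ-comm {1ℂ} *ℂ-identityˡ
      ; distrib    = Consequences.comm∧distrˡ⇒distr (×-setoid ℝR.setoid ℝR.setoid)
                       {_∙_ = _*ℂ_} {_+ℂ_} (λ {x} {x′} {y} {y′} → +ℂ-cong {x} {x′} {y} {y′})
                       *ℂ-comm *ℂ-distribˡ
      }
    ; *-comm = *ℂ-comm
    }
  }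
  where
  +ℂ-cong : ∀ {x x′ y y′} → x ≈ℂ x′ → y ≈ℂ y′ → x +ℂ y ≈ℂ x′ +ℂ y′
  +ℂ-cong {a , b} {a′ , b′} {c , d} {c′ , d′} (a≈ , b≈) (c≈ , d≈) =
    ℝR.+-cong {a} {a′} {c} {c′} a≈ c≈ , ℝR.+-cong {b} {b′} {d} {d′} b≈ d≈

module _ {c ℓ} (R : CommutativeRing c ℓ) where
  open CommutativeRing R hiding (refl; sym; trans)
  open RawMonoidDefs (Semiring.+-rawMonoid semiring) using () renaming (_×_ to _·_)
  private module R = CommutativeRing R

  IsUnit : Pred Carrier (c ⊔ ℓ)
  IsUnit = Invertible _≈_ 1# _*_

  Unit : Set (c ⊔ ℓ)
  Unit = Σ Carrier IsUnit

  private
    inverse-of-product : ∀ {x y x⁻¹ y⁻¹} →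
                         x⁻¹ * x ≈ 1# → y⁻¹ * y ≈ 1# → (x⁻¹ * y⁻¹) * (x * y) ≈ 1#
    inverse-of-product {x} {y} {x⁻¹} {y⁻¹} ex ey = begin
      (x⁻¹ * y⁻¹) * (x * y)  ≈⟨ interchange x⁻¹ y⁻¹ x y ⟩
      (x⁻¹ * x) * (y⁻¹ * y)  ≈⟨ *-cong ex ey ⟩
      1# * 1#                ≈⟨ *-identityˡ 1# ⟩
      1#                     ∎
      where
      open SetoidReasoning setoid
      open CommutativeSemigroupProperties *-commutativeSemigroup using (interchange)

  infixl 7 _*ᵘ_
  _*ᵘ_ : Unit → Unit → Unit
  (x , x⁻¹ , l , r) *ᵘ (y , y⁻¹ , l′ , r′) =
    x * y , x⁻¹ * y⁻¹ , inverse-of-product l l′ , inverse-of-product r r′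

  1ᵘ : Unit
  1ᵘ = 1# , 1# , *-identityˡ 1# , *-identityˡ 1#

  infix 8 _⁻¹ᵘ
  _⁻¹ᵘ : Unit → Unit
  (x , x⁻¹ , l , r) ⁻¹ᵘ = x⁻¹ , x , r , l

  unitGroup : AbelianGroup (c ⊔ ℓ) ℓ
  unitGroup = record
    { Carrier = Unit
    ; _≈_     = λ u v → proj₁ u ≈ proj₁ v
    ; _∙_     = _*ᵘ_
    ; ε       = 1ᵘ
    ; _⁻¹     = _⁻¹ᵘ
    ; isAbelianGroup = record
      { isGroup = record
        { isMonoid = record
          { isSemigroup = record
            { isMagma = record
              { isEquivalence = record { refl = R.refl ; sym = R.sym ; trans = R.trans }
              ; ∙-cong        = *-cong
              }
            ; assoc = λ u v w → *-assoc (proj₁ u) (proj₁ v) (proj₁ w)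
            }
          ; identity = (λ u → *-identityˡ (proj₁ u)) , (λ u → *-identityʳ (proj₁ u))
          }
        ; inverse = (λ u → proj₁ (proj₂ (proj₂ u))) , (λ u → proj₂ (proj₂ (proj₂ u)))
        ; ⁻¹-cong = λ {u} {v} → inverse-cong {u} {v}
        }
      ; comm = λ u v → *-comm (proj₁ u) (proj₁ v)
      }
    }
    where
    inverse-cong : ∀ {u v : Unit} → proj₁ u ≈ proj₁ v → proj₁ (u ⁻¹ᵘ) ≈ proj₁ (v ⁻¹ᵘ)
    inverse-cong {x , x⁻¹ , l , _} {y , y⁻¹ , _ , r′} x≈y = begin
      x⁻¹              ≈⟨ *-identityʳ x⁻¹ ⟨
      x⁻¹ * 1#         ≈⟨ *-congˡ r′ ⟨
      x⁻¹ * (y * y⁻¹)  ≈⟨ *-assoc x⁻¹ y y⁻¹ ⟨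
      (x⁻¹ * y) * y⁻¹  ≈⟨ *-congʳ (*-congˡ x≈y) ⟨
      (x⁻¹ * x) * y⁻¹  ≈⟨ *-congʳ l ⟩
      1# * y⁻¹         ≈⟨ *-identityˡ y⁻¹ ⟩
      y⁻¹              ∎
      where open SetoidReasoning setoid

  record IsFinite : Set (c ⊔ ℓ) where
    field
      size        : ℕ
      enumeration : Inverse (≡.setoid (Fin size)) setoid

    open Inverse enumeration public using () renaming (to to element; from to index)

    infix 4 _≟_
    _≟_ : Decidable _≈_
    x ≟ y = map′ index-injective (Inverse.from-cong enumeration) (index x Fin.≟ index y)
      where
      index-injective : index x ≡ index y → x ≈ y
      index-injective eq = R.trans (R.sym (Inverse.strictlyInverseˡ enumeration x))
        (R.trans (R.reflexive (cong element eq)) (Inverse.strictlyInverseˡ enumeration y))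

    isUnit? : ∀ x → Dec (IsUnit x)
    isUnit? x = map′ to-unit from-unit
      (Fin.any? λ i → (element i * x ≟ 1#) ×-dec (x * element i ≟ 1#))
      where
      to-unit : (∃[ i ] (element i * x ≈ 1# × x * element i ≈ 1#)) → IsUnit x
      to-unit (i , p) = element i , p
      from-unit : IsUnit x → ∃[ i ] (element i * x ≈ 1# × x * element i ≈ 1#)
      from-unit (y , l , r) = index y , R.trans (*-congʳ y′≈y) l , R.trans (*-congˡ y′≈y) r
        where
        y′≈y : element (index y) ≈ y
        y′≈y = Inverse.strictlyInverseˡ enumeration y

  IsField : Set (c ⊔ ℓ)
  IsField = ¬ (1# ≈ 0#) × (∀ x → ¬ (x ≈ 0#) → IsUnit x)

  ThreeIsUnit : Set (c ⊔ ℓ)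
  ThreeIsUnit = IsUnit (3 · 1#)

  HasCharacteristic : ℕ → Set ℓ
  HasCharacteristic p = ∀ n → (n · 1# ≈ 0#) ⇔ (p ℕ.∣ n)

  HasOddCharacteristic : Set ℓ
  HasOddCharacteristic = ∃[ p ] (HasCharacteristic p × ¬ (2 ℕ.∣ p))

  -- The level c ⊔ ℓ is that of the principal ideals λ x → ∃[ r ] x ≈ r * a.
  record Ideal : Set (lsuc (c ⊔ ℓ)) where
    field
      members  : Pred Carrier (c ⊔ ℓ)
      resp     : members Respects _≈_
      0∈       : 0# ∈ members
      +-closed : ∀ {x y} → x ∈ members → y ∈ members → x + y ∈ members
      *-closed : ∀ r {x} → x ∈ members → r * x ∈ members

  open Ideal

  zeroIdeal : Ideal
  zeroIdeal = record
    { members  = λ x → Lift c (x ≈ 0#)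
    ; resp     = λ { x≈y (lift x≈0) → lift (R.trans (R.sym x≈y) x≈0) }
    ; 0∈       = lift R.refl
    ; +-closed = λ { (lift x≈0) (lift y≈0) → lift (R.trans (+-cong x≈0 y≈0) (+-identityˡ 0#)) }
    ; *-closed = λ { r (lift x≈0) → lift (R.trans (*-congˡ x≈0) (zeroʳ r)) }
    }

  wholeRing : Ideal
  wholeRing = record
    { members  = λ _ → ⊤
    ; resp     = λ _ _ → tt
    ; 0∈       = tt
    ; +-closed = λ _ _ → tt
    ; *-closed = λ _ _ → tt
    }

  IsProper : Ideal → Set (c ⊔ ℓ)
  IsProper I = ¬ (members I ≐ members wholeRing)

  IsMaximal : Ideal → Set (lsuc (c ⊔ ℓ))
  IsMaximal I = IsProper I × (∀ J → IsProper J → members I ⊆ members J → members J ⊆ members I)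

  record IsLocal : Set (lsuc (c ⊔ ℓ)) where
    field
      M         : Ideal
      isMaximal : IsMaximal M
      unique    : ∀ I → IsMaximal I → members I ≐ members M

  module _ (I : Ideal) where
    infix 4 _~_
    _~_ : Carrier → Carrier → Set (c ⊔ ℓ)
    x ~ y = x - y ∈ members I

    private
      open SetoidReasoning setoid
      open RingProperties ring using (-1*x≈-x; -‿distribʳ-*)
      open AbelianGroupProperties +-abelianGroup using (⁻¹-anti-homo-//; ⁻¹-∙-comm)
      open CommutativeSemigroupProperties +-commutativeSemigroup using (interchange)

      ≈⇒~ : ∀ {x y} → x ≈ y → x ~ y
      ≈⇒~ {x} {y} x≈y = resp I (R.sym (R.trans (+-congʳ x≈y) (-‿inverseʳ y))) (0∈ I)

      neg-closed : ∀ {x} → x ∈ members I → - x ∈ members I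
      neg-closed {x} x∈I = resp I (-1*x≈-x x) (*-closed I (- 1#) x∈I)

      cancel-middle : ∀ x y z → (x - y) + (y - z) ≈ x - z
      cancel-middle x y z = begin
        (x - y) + (y - z)      ≈⟨ +-assoc x (- y) (y - z) ⟩
        x + (- y + (y - z))    ≈⟨ +-congˡ (+-assoc (- y) y (- z)) ⟨
        x + ((- y + y) - z)    ≈⟨ +-congˡ (+-congʳ (-‿inverseˡ y)) ⟩
        x + (0# - z)           ≈⟨ +-congˡ (+-identityˡ (- z)) ⟩
        x - z                  ∎

      ~-trans : ∀ {x y z} → x ~ y → y ~ z → x ~ z
      ~-trans {x} {y} {z} p q = resp I (cancel-middle x y z) (+-closed I p q)

      ~-+-cong : ∀ {x x′ y y′} → x ~ x′ → y ~ y′ → x + y ~ x′ + y′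
      ~-+-cong {x} {x′} {y} {y′} p q = resp I
        (begin
          (x - x′) + (y - y′)          ≈⟨ interchange x (- x′) y (- y′) ⟩
          (x + y) + (- x′ + - y′)      ≈⟨ +-congˡ (⁻¹-∙-comm x′ y′) ⟩
          (x + y) - (x′ + y′)          ∎)
        (+-closed I p q)

      ~-*-congˡ : ∀ z {x y} → x ~ y → z * x ~ z * y
      ~-*-congˡ z {x} {y} p = resp I
        (begin
          z * (x - y)          ≈⟨ distribˡ z x (- y) ⟩
          z * x + z * (- y)    ≈⟨ +-congˡ (-‿distribʳ-* z y) ⟨
          z * x - z * y        ∎)
        (*-closed I z p)

      ~-*-cong : ∀ {x x′ y y′} → x ~ x′ → y ~ y′ → x * y ~ x′ * y′
      ~-*-cong {x} {x′} {y} {y′} p q = ~-trans (~-*-congˡ x q)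
        (~-trans (≈⇒~ (*-comm x y′)) (~-trans (~-*-congˡ y′ p) (≈⇒~ (*-comm y′ x′))))

      ~-neg-cong : ∀ {x y} → x ~ y → - x ~ - y
      ~-neg-cong {x} {y} p = resp I (R.sym (⁻¹-∙-comm x (- y))) (neg-closed p)

    quotientRing : CommutativeRing c (c ⊔ ℓ)
    quotientRing = record
      { Carrier = Carrier
      ; _≈_     = _~_
      ; _+_     = _+_
      ; _*_     = _*_
      ; -_      = -_
      ; 0#      = 0#
      ; 1#      = 1#
      ; isCommutativeRing = record
        { isRing = record
          { +-isAbelianGroup = record
            { isGroup = record
              { isMonoid = record
                { isSemigroup = record
                  { isMagma = record
                    { isEquivalence = record
                      { refl  = ≈⇒~ R.refl
                      ; sym   = λ {x} {y} p → resp I (⁻¹-anti-homo-// x y) (neg-closed p)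
                      ; trans = ~-trans
                      }
                    ; ∙-cong = ~-+-cong
                    }
                  ; assoc = λ x y z → ≈⇒~ (+-assoc x y z)
                  }
                ; identity = (λ x → ≈⇒~ (+-identityˡ x)) , (λ x → ≈⇒~ (+-identityʳ x))
                }
              ; inverse = (λ x → ≈⇒~ (-‿inverseˡ x)) , (λ x → ≈⇒~ (-‿inverseʳ x))
              ; ⁻¹-cong = ~-neg-cong
              }
            ; comm = λ x y → ≈⇒~ (+-comm x y)
            }
          ; *-cong     = ~-*-cong
          ; *-assoc    = λ x y z → ≈⇒~ (*-assoc x y z)
          ; *-identity = (λ x → ≈⇒~ (*-identityˡ x)) , (λ x → ≈⇒~ (*-identityʳ x))
          ; distrib    = (λ x y z → ≈⇒~ (distribˡ x y z)) , (λ x y z → ≈⇒~ (distribʳ x y z))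
          }
        ; *-comm = λ x y → ≈⇒~ (*-comm x y)
        }
      }

  residueField : IsLocal → CommutativeRing c (c ⊔ ℓ)
  residueField local = quotientRing (IsLocal.M local)

module _ {c ℓ} (R : CommutativeRing c ℓ) where
  open CommutativeRing R hiding (refl; sym; trans)
  open Ideal using (members)

  AdditiveCharacter : Set (c ⊔ ℓ)
  AdditiveCharacter = GroupHomomorphism
    (AbelianGroup.rawGroup +-abelianGroup)
    (AbelianGroup.rawGroup (unitGroup ℂ-commutativeRing))

  MultiplicativeCharacter : Set (c ⊔ ℓ)
  MultiplicativeCharacter = GroupHomomorphism
    (AbelianGroup.rawGroup (unitGroup R))
    (AbelianGroup.rawGroup (unitGroup ℂ-commutativeRing))

  infix 9 _⟨_⟩ᵃ _⟨_⟩ᵐ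
  _⟨_⟩ᵃ : AdditiveCharacter → Carrier → ℂ
  ψ ⟨ x ⟩ᵃ = proj₁ (GroupHomomorphism.⟦_⟧ ψ x)

  _⟨_⟩ᵐ : MultiplicativeCharacter → Unit R → ℂ
  τ ⟨ u ⟩ᵐ = proj₁ (GroupHomomorphism.⟦_⟧ τ u)

  IsPrimitiveᵃ : AdditiveCharacter → Set (lsuc (c ⊔ ℓ))
  IsPrimitiveᵃ ψ =
    ∀ (I : Ideal R) → (∀ {x} → x ∈ members I → ψ ⟨ x ⟩ᵃ ≈ℂ 1ℂ) →
    members I ≐ members (zeroIdeal R)

  IsFrobenius : Set (lsuc (c ⊔ ℓ))
  IsFrobenius = ∃[ ψ ] IsPrimitiveᵃ ψ

  IsTrivial : MultiplicativeCharacter → Set (c ⊔ ℓ)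
  IsTrivial τ = ∀ u → τ ⟨ u ⟩ᵐ ≈ℂ 1ℂ

  -- For I ⊆ M every element of 1 + I is a unit, so that quantifying over the
  -- units in 1 + I loses nothing.
  IsTrivialOn1+ : MultiplicativeCharacter → Ideal R → Set (c ⊔ ℓ)
  IsTrivialOn1+ τ I = ∀ u {z} → z ∈ members I → proj₁ u ≈ 1# + z → τ ⟨ u ⟩ᵐ ≈ℂ 1ℂ

  module _ (local : IsLocal R) where
    open IsLocal local using (M)

    IsConductor : MultiplicativeCharacter → Ideal R → Set (lsuc (c ⊔ ℓ))
    IsConductor τ I =
        (IsTrivial τ × members I ≐ members (wholeRing R))
      ⊎ (¬ IsTrivial τ ×
         members I ⊆ members M × IsTrivialOn1+ τ I ×
         (∀ J → members J ⊆ members M → IsTrivialOn1+ τ J → members J ⊆ members I))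

    IsPrimitiveᵐ : MultiplicativeCharacter → Set (lsuc (c ⊔ ℓ))
    IsPrimitiveᵐ τ = IsConductor τ (zeroIdeal R)

  extendByZero : (Unit R → ℂ) → ∀ {x} → Dec (IsUnit R x) → ℂ
  extendByZero f {x} (yes x∈Rˣ) = f (x , x∈Rˣ)
  extendByZero f     (no _)     = 0ℂ

  module _ (finite : IsFinite R) where
    open IsFinite finite using (element; isUnit?)

    -- The enumeration meets each ≈-class of R exactly once, so each unit
    -- contributes one term, for f respecting equality of units.
    ∑ˣ : (Unit R → ℂ) → ℂ
    ∑ˣ f = RawMonoidDefs.sum (CommutativeRing.+-rawMonoid ℂ-commutativeRing)
      (λ i → extendByZero f (isUnit? (element i)))

    kloosterman : AdditiveCharacter → MultiplicativeCharacter → Carrier → ℂ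
    kloosterman ψ τ a = ∑ˣ λ u →
      τ ⟨ u ⟩ᵐ *ℂ ψ ⟨ proj₁ u + a * proj₁ (_⁻¹ᵘ R u) ⟩ᵃ

infixr 8 _^ℂ_
_^ℂ_ : ℂ → ℕ → ℂ
_^ℂ_ = RawSemiringDefs._^_ (Semiring.rawSemiring (CommutativeRing.semiring ℂ-commutativeRing))

{-# OPTIONS --safe #-}

-- A non-primitive τ is trivial on 1 + Rz for some z ≠ 0 with z² = 0: take a
-- suitable power of a nonzero element of an ideal J ⊆ M such that τ is trivial
-- on 1 + J, the maximal ideal of a finite local ring being nil. If a function
-- h on the units satisfies h((1 + rz)u) = h(u) ψ(rzc(u)) for all r, then
-- averaging ∑ h(u) over the translations by 1 + rz shows that only the u with
-- zc(u) = 0 contribute, because ψ is primitive. Applied to the sum K(a) this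
-- leaves the u with z(u - au⁻¹) = 0. Once the cube has been expanded, applied
-- to the sum over a it leaves the a with za(u⁻¹ + v⁻¹ + w⁻¹) = 0. These
-- equations force 3za² = 0, so no term survives.
--
-- Equality of complex numbers is undecidable, but x ≈ 0 is stable under double
-- negation, so that one may argue classically.

module Submission where

open import Algebra.Bundles using (CommutativeRing; AbelianGroup)
open import Algebra.Morphism.Bundles using (GroupHomomorphism)
import Algebra.Definitions.RawMonoid as RawMonoidDefs
import Algebra.Properties.AbelianGroup as AbelianGroupProperties
import Algebra.Properties.CommutativeSemigroup as CommutativeSemigroupProperties
import Algebra.Properties.Ring as RingProperties
import Algebra.Properties.Semiring.Exp as Exp
import Algebra.Properties.Semiring.Mult as SemiringMult
import Algebra.Properties.Semiring.Sum as Sum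
import Algebra.Solver.Ring.NaturalCoefficients.Default as NaturalCoefficients
open import Data.Fin.Base as Fin using (Fin)
open import Data.Fin.Permutation using (Permutation′; permutation; _⟨$⟩ʳ_)
import Data.Fin.Properties as Fin
open import Data.List.Base using (List; []; _∷_; tabulate)
open import Data.List.Membership.Propositional using () renaming (_∈_ to _∈ˡ_)
open import Data.List.Membership.Propositional.Properties using (∈-tabulate⁺)
open import Data.List.Relation.Unary.Any using (here; there)
open import Data.Nat.Base as ℕ using (ℕ; zero; suc)
import Data.Nat.Properties as ℕ
open import Data.Product.Base using (∃-syntax; _×_; _,_; proj₁; proj₂)
open import Data.Rational.Base using (ℚ; 0ℚ; 1ℚ; ½; ∣_∣)
import Data.Rational.Base as ℚ
import Data.Rational.Properties as ℚ
open import Data.Rational.Solver using (module +-*-Solver)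
open import Data.Sum.Base using (_⊎_; inj₁; inj₂)
open import Data.Unit.Polymorphic.Base using (tt)
open import Function.Base using (_∘_)
open import Function.Bundles using (Inverse)
open import Level using (Level; lift; lower)
open import Relation.Binary.PropositionalEquality as ≡ using (_≡_)
import Relation.Binary.Reasoning.Setoid as SetoidReasoning
open import Relation.Nullary using (¬_; Dec; yes; no; contradiction)
open import Relation.Nullary.Decidable using (map′; decidable-stable)
import Relation.Unary as Unary
open import Relation.Unary using (_∈_; _∉_; _⊆_)
open import Defs

-- Real and complex numbers

module ℝR = CommutativeRing ℝ-commutativeRing
module ℂR = CommutativeRing ℂ-commutativeRing

module ComplexField where
  open ℝ using (seq; cauchy)
  open import Data.Rational.Base using (_+_; _*_; _-_; -_; _<_; _≤_)
  open ≡ using (refl; sym; cong; subst)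
  open RawMonoidDefs ℂR.+-rawMonoid using () renaming (_×_ to _·_)

  0ℝ : ℝ
  0ℝ = fromℚ 0ℚ

  -- A positive form of being nonzero, whose witness is passed on to products. Equality with zero
  -- turns out to be its negation and is therefore stable.
  Apart0 : ℝ → Set
  Apart0 x = ∃[ ε ] (0ℚ < ε × ∃[ N ] ∀ n → N ℕ.≤ n → ε ≤ ∣ seq x n ∣)

  ∣p-0∣≡∣p∣ : ∀ p → ∣ p - 0ℚ ∣ ≡ ∣ p ∣
  ∣p-0∣≡∣p∣ p = cong ∣_∣ (ℚ.+-identityʳ p)

  ∣p∣<∣p-q∣+∣q∣ : ∀ p q {δ δ′} → ∣ p - q ∣ < δ → ∣ q ∣ < δ′ → ∣ p ∣ < δ + δ′
  ∣p∣<∣p-q∣+∣q∣ p q {δ} {δ′} near small = subst (λ x → ∣ x ∣ < δ + δ′) (add-subtract p q)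
    (ℚ.≤-<-trans (ℚ.∣p+q∣≤∣p∣+∣q∣ (p - q) q) (ℚ.+-mono-< near small))

  apart0⇒≉0 : ∀ x → Apart0 x → ¬ x ≈ℝ 0ℝ
  apart0⇒≉0 x (ε , 0<ε , N , far) x≈0 with x≈0 ε 0<ε
  ... | N′ , near = ℚ.<-irrefl refl (ℚ.≤-<-trans (far n (ℕ.m≤m⊔n N N′))
          (subst (_< ε) (∣p-0∣≡∣p∣ (seq x n)) (near n n (ℕ.m≤n⊔m N N′) (ℕ.m≤n⊔m N N′))))
    where n = N ℕ.⊔ N′

  -- Comparing one late rational term with `½ * ε` decides the matter. If it is smaller, all later
  -- terms stay below `ε`; if not, later terms lie within a quarter of `ε` of it and keep at least
  -- that distance from zero, so that `x` would be apart from zero.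
  ¬apart0⇒≈0 : ∀ x → ¬ Apart0 x → x ≈ℝ 0ℝ
  ¬apart0⇒≈0 x ¬apart ε 0<ε
    with cauchy x (½ * ε) (half-pos ε 0<ε)
       | cauchy x (½ * (½ * ε)) (half-pos (½ * ε) (half-pos ε 0<ε))
  ... | N , near | N′ , nearer = M , small (∣ seq x M ∣ ℚ.<? ½ * ε)
    where
    M = N ℕ.⊔ N′
    N≤M = ℕ.m≤m⊔n N N′
    N′≤M = ℕ.m≤n⊔m N N′
    small : _ → ∀ m n → M ℕ.≤ m → M ℕ.≤ n → ∣ seq x m - 0ℚ ∣ < ε
    small (yes x[M]<½ε) m _ M≤m _ = subst (_< ε) (sym (∣p-0∣≡∣p∣ (seq x m)))
      (subst (∣ seq x m ∣ <_) (half+half ε)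
        (∣p∣<∣p-q∣+∣q∣ (seq x m) (seq x M) (near m M (ℕ.≤-trans N≤M M≤m) N≤M) x[M]<½ε))
    small (no x[M]≮½ε) with () ← ¬apart (½ * (½ * ε) , half-pos (½ * ε) (half-pos ε 0<ε) , M ,
      λ n M≤n → ℚ.≮⇒≥ λ x[n]<¼ε → x[M]≮½ε (subst (∣ seq x M ∣ <_) (half+half (½ * ε))
        (∣p∣<∣p-q∣+∣q∣ (seq x M) (seq x n) (nearer M n N′≤M (ℕ.≤-trans N′≤M M≤n)) x[n]<¼ε)))

  ≈ℝ0-stable : ∀ x → ¬ ¬ x ≈ℝ 0ℝ → x ≈ℝ 0ℝ
  ≈ℝ0-stable x ¬¬x≈0 = ¬apart0⇒≈0 x λ apart → ¬¬x≈0 (apart0⇒≉0 x apart)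

  *-mono-≤-nonNeg : ∀ {p q r s} → 0ℚ ≤ p → p ≤ q → 0ℚ ≤ r → r ≤ s → p * r ≤ q * s
  *-mono-≤-nonNeg {p} {q} {r} {s} 0≤p p≤q 0≤r r≤s = ℚ.≤-trans
    (ℚ.*-monoʳ-≤-nonNeg r {{ℚ.nonNegative 0≤r}} p≤q)
    (ℚ.*-monoˡ-≤-nonNeg q {{ℚ.nonNegative (ℚ.≤-trans 0≤p p≤q)}} r≤s)

  apart0-* : ∀ x y → Apart0 x → Apart0 y → Apart0 (x *ℝ y)
  apart0-* x y (ε , 0<ε , N , far) (ε′ , 0<ε′ , N′ , far′) =
    ε * ε′ ,
    subst (_< ε * ε′) (ℚ.*-zeroʳ ε) (ℚ.*-monoʳ-<-pos ε {{ℚ.positive 0<ε}} 0<ε′) ,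
    N ℕ.⊔ N′ ,
    λ n M≤n → subst (ε * ε′ ≤_) (sym (ℚ.∣p*q∣≡∣p∣*∣q∣ (seq x n) (seq y n)))
      (*-mono-≤-nonNeg (ℚ.<⇒≤ 0<ε) (far n (ℕ.m⊔n≤o⇒m≤o N N′ M≤n))
                (ℚ.<⇒≤ 0<ε′) (far′ n (ℕ.m⊔n≤o⇒n≤o N N′ M≤n)))

  0≤p*p : ∀ p → 0ℚ ≤ p * p
  0≤p*p p = subst (0ℚ ≤_) (∣p∣*∣p∣≡p*p (ℚ.∣p∣≡p∨∣p∣≡-p p))
    (*-mono-≤-nonNeg ℚ.≤-refl (ℚ.0≤∣p∣ p) ℚ.≤-refl (ℚ.0≤∣p∣ p))
    where
    open +-*-Solver
    ∣p∣*∣p∣≡p*p : ∣ p ∣ ≡ p ⊎ ∣ p ∣ ≡ - p → ∣ p ∣ * ∣ p ∣ ≡ p * p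
    ∣p∣*∣p∣≡p*p (inj₁ eq) rewrite eq = refl
    ∣p∣*∣p∣≡p*p (inj₂ eq) rewrite eq = solve 1 (λ p → (:- p) :* (:- p) := p :* p) refl p

  ∥_∥² : ℂ → ℝ
  ∥ (a , b) ∥² = a *ℝ a +ℝ b *ℝ b

  apart0-+ : ∀ x y → (∀ n → 0ℚ ≤ seq x n) → (∀ n → 0ℚ ≤ seq y n) → Apart0 x → Apart0 (x +ℝ y)
  apart0-+ x y 0≤x 0≤y (ε , 0<ε , N , far) = ε , 0<ε , N , λ n N≤n →
    ℚ.≤-trans (far n N≤n)
      (ℚ.≤-trans (ℚ.≤-reflexive (ℚ.0≤p⇒∣p∣≡p (0≤x n)))
        (ℚ.≤-trans (x≤x+y n) (ℚ.≤-reflexive (sym (ℚ.0≤p⇒∣p∣≡p (ℚ.≤-trans (0≤x n) (x≤x+y n)))))))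
    where
    x≤x+y : ∀ n → seq x n ≤ seq x n + seq y n
    x≤x+y n = subst (_≤ seq x n + seq y n) (ℚ.+-identityʳ (seq x n)) (ℚ.+-monoʳ-≤ (seq x n) (0≤y n))

  ∥∥²-apart0ˡ : ∀ a b → Apart0 a → Apart0 ∥ a , b ∥²
  ∥∥²-apart0ˡ a b a#0 = apart0-+ (a *ℝ a) (b *ℝ b)
    (λ n → 0≤p*p (seq a n)) (λ n → 0≤p*p (seq b n)) (apart0-* a a a#0 a#0)

  ∥∥²-apart0ʳ : ∀ a b → Apart0 b → Apart0 ∥ a , b ∥²
  ∥∥²-apart0ʳ a b b#0 with ∥∥²-apart0ˡ b a b#0
  ... | ε , 0<ε , N , far = ε , 0<ε , N , λ n N≤n →
    subst (λ q → ε ≤ ∣ q ∣) (ℚ.+-comm (seq b n * seq b n) (seq a n * seq a n)) (far n N≤n)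

  ≈0-stable : ∀ x → ¬ ¬ x ≈ℂ 0ℂ → x ≈ℂ 0ℂ
  ≈0-stable (a , b) ¬¬x≈0 =
    ≈ℝ0-stable a (λ a≉0 → ¬¬x≈0 (a≉0 ∘ proj₁)) , ≈ℝ0-stable b (λ b≉0 → ¬¬x≈0 (b≉0 ∘ proj₂))

  ¬∥∥²-apart0⇒≈0 : ∀ x → ¬ Apart0 ∥ x ∥² → x ≈ℂ 0ℂ
  ¬∥∥²-apart0⇒≈0 (a , b) ¬apart =
    ¬apart0⇒≈0 a (¬apart ∘ ∥∥²-apart0ˡ a b) , ¬apart0⇒≈0 b (¬apart ∘ ∥∥²-apart0ʳ a b)

  ∥∥²-zero : ∀ x → x ≈ℂ 0ℂ → ∥ x ∥² ≈ℝ 0ℝ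
  ∥∥²-zero (a , b) (a≈0 , b≈0) =
    ℝR.trans {∥ a , b ∥²} {a *ℝ 0ℝ +ℝ b *ℝ 0ℝ} {0ℝ}
      (ℝR.+-cong {a *ℝ a} {a *ℝ 0ℝ} {b *ℝ b} {b *ℝ 0ℝ}
        (ℝR.*-congˡ {a} {a} {0ℝ} a≈0) (ℝR.*-congˡ {b} {b} {0ℝ} b≈0))
      (pointwise (a *ℝ 0ℝ +ℝ b *ℝ 0ℝ) 0ℝ λ n → p*0+q*0≡0 (seq a n) (seq b n))
    where
    p*0+q*0≡0 : ∀ p q → p * 0ℚ + q * 0ℚ ≡ 0ℚ
    p*0+q*0≡0 p q rewrite ℚ.*-zeroʳ p | ℚ.*-zeroʳ q = refl

  ∥∥²-* : ∀ x y → ∥ x ∥² *ℝ ∥ y ∥² ≈ℝ ∥ x *ℂ y ∥²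
  ∥∥²-* x@(a , b) y@(c , d) = pointwise (∥ x ∥² *ℝ ∥ y ∥²) ∥ x *ℂ y ∥²
    λ n → brahmagupta (seq a n) (seq b n) (seq c n) (seq d n)
    where
    open +-*-Solver
    brahmagupta : ∀ a b c d → (a * a + b * b) * (c * c + d * d) ≡
      (a * c + (- (b * d))) * (a * c + (- (b * d))) + (a * d + b * c) * (a * d + b * c)
    brahmagupta = solve 4 (λ a b c d → (a :* a :+ b :* b) :* (c :* c :+ d :* d) :=
      (a :* c :+ (:- (b :* d))) :* (a :* c :+ (:- (b :* d)))
        :+ (a :* d :+ b :* c) :* (a :* d :+ b :* c)) refl

  -- The squared modulus is multiplicative, which reduces the claim to the reals. Both moduli may be
  -- assumed apart from zero; then so is their product, yet it is the squared modulus of a number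
  -- equal to zero.
  noZeroDivisors : ∀ x y → ¬ x ≈ℂ 0ℂ → x *ℂ y ≈ℂ 0ℂ → y ≈ℂ 0ℂ
  noZeroDivisors x y x≉0 xy≈0 = ¬∥∥²-apart0⇒≈0 y λ y#0 →
    x≉0 (¬∥∥²-apart0⇒≈0 x λ x#0 →
      apart0⇒≉0 (∥ x ∥² *ℝ ∥ y ∥²) (apart0-* ∥ x ∥² ∥ y ∥² x#0 y#0)
        (ℝR.trans {∥ x ∥² *ℝ ∥ y ∥²} {∥ x *ℂ y ∥²} {0ℝ} (∥∥²-* x y) (∥∥²-zero (x *ℂ y) xy≈0)))

  -- Every term of the real part is one plus something nonnegative. This is what allows division by
  -- the order of the ring after averaging.
  characteristicZero : ∀ n → ¬ suc n · 1ℂ ≈ℂ 0ℂ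
  characteristicZero n (re≈0 , _) = apart0⇒≉0 (proj₁ (suc n · 1ℂ))
    (1ℚ , 0<1 , 0 , λ k _ → subst (1ℚ ≤_) (sym (ℚ.0≤p⇒∣p∣≡p (nonNeg (suc n) k))) (1≤ k))
    re≈0
    where
    nonNeg : ∀ n k → 0ℚ ≤ seq (proj₁ (n · 1ℂ)) k
    nonNeg zero    k = ℚ.≤-refl
    nonNeg (suc n) k = ℚ.+-mono-≤ (ℚ.<⇒≤ 0<1) (nonNeg n k)
    1≤ : ∀ k → 1ℚ ≤ seq (proj₁ (suc n · 1ℂ)) k
    1≤ k = ℚ.+-monoʳ-≤ 1ℚ (nonNeg n k)

-- Finite local rings

module FiniteRing {c ℓ} (R : CommutativeRing c ℓ) (finite : IsFinite R) where
  open CommutativeRing R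
  open IsFinite finite
  open module IdealOfR = Ideal {R = R}
  open NaturalCoefficients commutativeSemiring using (solve; _:=_; _:+_; _:*_)
  open AbelianGroupProperties +-abelianGroup using (inverseˡ-unique)
  open RingProperties ring using (-‿distribˡ-*; -1*x≈-x)
  open SetoidReasoning setoid

  element-index : ∀ x → element (index x) ≈ x
  element-index = Inverse.strictlyInverseˡ enumeration

  -- Existence of maximal ideals

  -- The ideal `I + Re`. The sign in `x + r * e` keeps subtraction out of the closure proofs, which
  -- are thus identities of commutative semirings.
  addGenerator : Ideal R → Carrier → Ideal R
  addGenerator I e = record
    { members  = λ x → ∃[ r ] (x + r * e ∈ members I)
    ; resp     = λ { x≈y (r , p) → r , resp I (+-congʳ x≈y) p }
    ; 0∈       = 0# , resp I (sym (trans (+-identityˡ _) (zeroˡ e))) (0∈ I)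
    ; +-closed = λ { {x} {y} (r , p) (s , q) → r + s , resp I
        (solve 5 (λ x y r s e → (x :+ r :* e) :+ (y :+ s :* e) := (x :+ y) :+ (r :+ s) :* e)
          refl x y r s e)
        (+-closed I p q) }
    ; *-closed = λ { t {x} (r , p) → t * r , resp I
        (solve 4 (λ t x r e → t :* (x :+ r :* e) := t :* x :+ (t :* r) :* e) refl t x r e)
        (*-closed I t p) }
    }

  addGenerator-⊇ : ∀ I e → members I ⊆ members (addGenerator I e)
  addGenerator-⊇ I e x∈I = 0# , resp I (sym (trans (+-congˡ (zeroˡ e)) (+-identityʳ _))) x∈I

  addGenerator-∋ : ∀ I e → e ∈ members (addGenerator I e)
  addGenerator-∋ I e = - 1# , resp I (sym (trans (+-congˡ (-1*x≈-x e)) (-‿inverseʳ e))) (0∈ I)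

  neg-closed : ∀ I {x} → x ∈ members I → - x ∈ members I
  neg-closed I {x} x∈I = resp I (-1*x≈-x x) (*-closed I (- 1#) x∈I)

  addGenerator-⊆ : ∀ I J {e} → members I ⊆ members J → e ∈ members J →
                   members (addGenerator I e) ⊆ members J
  addGenerator-⊆ I J {e} I⊆J e∈J {x} (r , p) = resp J
    (trans (+-assoc x (r * e) (- (r * e)))
      (trans (+-congˡ (-‿inverseʳ (r * e))) (+-identityʳ x)))
    (+-closed J (I⊆J p) (neg-closed J (*-closed J r e∈J)))

  addGenerator? : ∀ I e → Unary.Decidable (members I) →
                  Unary.Decidable (members (addGenerator I e))
  addGenerator? I e I? x = map′
    (λ (i , p) → element i , p)
    (λ (r , p) → index r , resp I (+-congˡ (*-congʳ (sym (element-index r)))) p)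
    (Fin.any? λ i → I? (x + element i * e))

  DecidableIdeal : Set _
  DecidableIdeal = ∃[ I ] Unary.Decidable (members I)

  extend : DecidableIdeal → Carrier → DecidableIdeal
  extend (I , I?) e with addGenerator? I e I? 1#
  ... | yes _ = I , I?
  ... | no  _ = addGenerator I e , addGenerator? I e I?

  extend-⊇ : ∀ I e → members (proj₁ I) ⊆ members (proj₁ (extend I e))
  extend-⊇ (I , I?) e x∈I with addGenerator? I e I? 1#
  ... | yes _ = x∈I
  ... | no  _ = addGenerator-⊇ I e x∈I

  extend-∌1 : ∀ I e → 1# ∉ members (proj₁ I) → 1# ∉ members (proj₁ (extend I e))
  extend-∌1 (I , I?) e 1∉I with addGenerator? I e I? 1#
  ... | yes _ = 1∉I
  ... | no 1∉ = 1∉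

  -- An element is rejected only if `I + Re` contains `1#`; as `J` contains `I + Re`, that cannot
  -- happen here.
  extend-∋ : ∀ I e J → members (proj₁ I) ⊆ members J → e ∈ members J → 1# ∉ members J →
             e ∈ members (proj₁ (extend I e))
  extend-∋ (I , I?) e J I⊆J e∈J 1∉J with addGenerator? I e I? 1#
  ... | yes 1∈ = contradiction (addGenerator-⊆ I J I⊆J e∈J 1∈) 1∉J
  ... | no  _  = addGenerator-∋ I e

  -- Adjoining every element of R in turn, except those that would generate the
  -- unit ideal, leads to a maximal ideal.
  extendAll : DecidableIdeal → List Carrier → DecidableIdeal
  extendAll I []       = I
  extendAll I (e ∷ es) = extendAll (extend I e) es

  extendAll-⊇ : ∀ I es → members (proj₁ I) ⊆ members (proj₁ (extendAll I es))
  extendAll-⊇ I []       x∈I = x∈I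
  extendAll-⊇ I (e ∷ es) x∈I = extendAll-⊇ (extend I e) es (extend-⊇ I e x∈I)

  extendAll-∌1 : ∀ I es → 1# ∉ members (proj₁ I) → 1# ∉ members (proj₁ (extendAll I es))
  extendAll-∌1 I []       1∉I = 1∉I
  extendAll-∌1 I (e ∷ es) 1∉I = extendAll-∌1 (extend I e) es (extend-∌1 I e 1∉I)

  -- The ideal reached when the turn of `e` comes lies in the final one, hence in `J`, so `e` is
  -- accepted at that stage.
  extendAll-∋ : ∀ I es J {e} → members (proj₁ (extendAll I es)) ⊆ members J → 1# ∉ members J →
                e ∈ˡ es → e ∈ members J → e ∈ members (proj₁ (extendAll I es))
  extendAll-∋ I (e ∷ es) J ⊆J 1∉J (here ≡.refl) e∈J =
    extendAll-⊇ (extend I e) es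
      (extend-∋ I e J (λ x∈I → ⊆J (extendAll-⊇ I (e ∷ es) x∈I)) e∈J 1∉J)
  extendAll-∋ I (e ∷ es) J ⊆J 1∉J (there e∈es) e∈J = extendAll-∋ (extend I e) es J ⊆J 1∉J e∈es e∈J

  proper⇒∌1 : ∀ I → IsProper R I → 1# ∉ members I
  proper⇒∌1 I proper 1∈I =
    proper ((λ _ → tt) , λ {x} _ → resp I (*-identityʳ x) (*-closed I x 1∈I))

  ∌1⇒proper : ∀ I → 1# ∉ members I → IsProper R I
  ∌1⇒proper I 1∉I (_ , R⊆I) = 1∉I (R⊆I tt)

  -- The ideal `Rx` is proper and decidable, so the extension process can start from it. Since every
  -- class of `R` is listed, a proper ideal above the result can contain nothing new.
  nonunit⇒∈maximal : ∀ {x} → ¬ IsUnit R x → ∃[ I ] (IsMaximal R I × x ∈ members I)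
  nonunit⇒∈maximal {x} x∉Rˣ = max , (∌1⇒proper max 1∉max , maximal) , extendAll-⊇ ⟨x⟩ elements
      (addGenerator-∋ (zeroIdeal R) x)
    where
    elements : List Carrier
    elements = tabulate element

    ⟨x⟩ : DecidableIdeal
    ⟨x⟩ = addGenerator (zeroIdeal R) x ,
      addGenerator? (zeroIdeal R) x λ y → map′ lift lower (y ≟ 0#)

    max : Ideal R
    max = proj₁ (extendAll ⟨x⟩ elements)

    1∉⟨x⟩ : 1# ∉ members (proj₁ ⟨x⟩)
    1∉⟨x⟩ (r , lift 1+rx≈0) = x∉Rˣ (- r , -rx≈1 , trans (*-comm x (- r)) -rx≈1)
      where
      -rx≈1 : - r * x ≈ 1#
      -rx≈1 = trans (sym (-‿distribˡ-* r x)) (sym (inverseˡ-unique 1# (r * x) 1+rx≈0))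

    1∉max : 1# ∉ members max
    1∉max = extendAll-∌1 ⟨x⟩ elements 1∉⟨x⟩

    maximal : ∀ J → IsProper R J → members max ⊆ members J → members J ⊆ members max
    maximal J J-proper max⊆J {y} y∈J = resp max (element-index y)
      (extendAll-∋ ⟨x⟩ elements J max⊆J (proper⇒∌1 J J-proper) (∈-tabulate⁺ (index y))
        (resp J (sym (element-index y)) y∈J))

  -- Nilpotence in the maximal ideal and non-primitive characters

  module Local (local : IsLocal R) where
    open IsLocal local
    open Exp semiring

    1∉M : 1# ∉ members M
    1∉M = proper⇒∌1 M (proj₁ isMaximal)

    nonunit⇒∈M : ∀ {x} → ¬ IsUnit R x → x ∈ members M
    nonunit⇒∈M x∉Rˣ with nonunit⇒∈maximal x∉Rˣ
    ... | I , I-maximal , x∈I = proj₁ (unique I I-maximal) x∈I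

    -- Otherwise `1# - x` would lie in `M` as well, and adding `x` would put `1#` there.
    ∈M⇒1-unit : ∀ {x} → x ∈ members M → IsUnit R (1# - x)
    ∈M⇒1-unit {x} x∈M = decidable-stable (isUnit? (1# - x)) λ 1-x∉Rˣ →
      1∉M (resp M (trans (+-assoc 1# (- x) x) (trans (+-congˡ (-‿inverseˡ x)) (+-identityʳ 1#)))
        (+-closed M (nonunit⇒∈M 1-x∉Rˣ) x∈M))

    -- Nakayama's lemma for a principal ideal: the unit `1# - y` annihilates `x`.
    x≈yx⇒x≈0 : ∀ {x y} → y ∈ members M → x ≈ y * x → x ≈ 0#
    x≈yx⇒x≈0 {x} {y} y∈M x≈yx with ∈M⇒1-unit y∈M
    ... | v , v[1-y]≈1 , _ = begin
      x                        ≈⟨ *-identityˡ x ⟨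
      1# * x                   ≈⟨ *-congʳ v[1-y]≈1 ⟨
      (v * (1# - y)) * x       ≈⟨ *-assoc v (1# - y) x ⟩
      v * ((1# - y) * x)       ≈⟨ *-congˡ (distribʳ x 1# (- y)) ⟩
      v * (1# * x + - y * x)   ≈⟨ *-congˡ (+-cong (*-identityˡ x) (sym (-‿distribˡ-* y x))) ⟩
      v * (x - y * x)          ≈⟨ *-congˡ (+-congʳ x≈yx) ⟩
      v * (y * x - y * x)      ≈⟨ *-congˡ (-‿inverseʳ (y * x)) ⟩
      v * 0#                   ≈⟨ zeroʳ v ⟩
      0#                       ∎

    -- Among `size + 1` powers of `y` two coincide; the lower one is then a multiple of itself by an
    -- element of `M`, hence zero.
    ∈M⇒nilpotent : ∀ {y} → y ∈ members M → ∃[ k ] y ^ k ≈ 0#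
    ∈M⇒nilpotent {y} y∈M
      with Fin.pigeonhole (ℕ.n<1+n size) (λ i → index (y ^ Fin.toℕ i))
    ... | i , j , i<j , index≡ = Fin.toℕ i , x≈yx⇒x≈0 (*-closed M (y ^ d) y∈M) (begin
      y ^ Fin.toℕ i                    ≈⟨ element-index (y ^ Fin.toℕ i) ⟨
      element (index (y ^ Fin.toℕ i))  ≡⟨ ≡.cong element index≡ ⟩
      element (index (y ^ Fin.toℕ j))  ≈⟨ element-index (y ^ Fin.toℕ j) ⟩
      y ^ Fin.toℕ j                    ≡⟨ ≡.cong (y ^_) (ℕ.m∸n+n≡m i<j) ⟨
      y ^ (d ℕ.+ suc (Fin.toℕ i))      ≈⟨ ^-homo-* y d (suc (Fin.toℕ i)) ⟩
      y ^ d * (y * y ^ Fin.toℕ i)      ≈⟨ *-assoc (y ^ d) y (y ^ Fin.toℕ i) ⟨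
      (y ^ d * y) * y ^ Fin.toℕ i      ∎)
      where
      d : ℕ
      -- One less than the gap between the exponents: a factor `y` is left over, which puts the
      -- multiplier `y ^ d * y` in `M`.
      d = Fin.toℕ j ℕ.∸ suc (Fin.toℕ i)

    -- Keep multiplying by `y` until one more factor would give zero. The last nonzero multiple
    -- `r * y` is annihilated by `y`, hence by itself.
    squareZeroMultiple : ∀ {y} → y ∈ members M → ¬ y ≈ 0# →
                         ∃[ r ] (¬ r * y ≈ 0# × (r * y) * (r * y) ≈ 0#)
    squareZeroMultiple {y} y∈M y≉0 =
      let k , yᵏ≈0 = ∈M⇒nilpotent y∈M
      in search k 1# (λ 1y≈0 → y≉0 (trans (sym (*-identityˡ y)) 1y≈0))
           (trans (*-congʳ yᵏ≈0) (zeroˡ (1# * y)))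
      where
      -- The exponent `k` bounds the remaining multiplications; at zero the two invariants
      -- contradict each other.
      search : ∀ k r → ¬ r * y ≈ 0# → y ^ k * (r * y) ≈ 0# →
               ∃[ r ] (¬ r * y ≈ 0# × (r * y) * (r * y) ≈ 0#)
      search zero    r ry≉0 ry≈0 = contradiction (trans (sym (*-identityˡ (r * y))) ry≈0) ry≉0
      search (suc k) r ry≉0 yᵏry≈0 with y * (r * y) ≟ 0#
      ... | yes yry≈0 = r , ry≉0 , trans (*-assoc r y (r * y)) (trans (*-congˡ yry≈0) (zeroʳ r))
      ... | no  yry≉0 = search k (y * r) (λ eq → yry≉0 (trans (sym (*-assoc y r y)) eq)) (begin
        y ^ k * ((y * r) * y)   ≈⟨ solve 3 (λ p y r → p :* ((y :* r) :* y) := (y :* p) :* (r :* y)) refl (y ^ k) y r ⟩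
        (y * y ^ k) * (r * y)   ≈⟨ yᵏry≈0 ⟩
        0#                      ∎)

    SquareZero-TrivialOn1+ : MultiplicativeCharacter R → Carrier → Set _
    SquareZero-TrivialOn1+ τ z = ¬ z ≈ 0# × z * z ≈ 0# ×
      (∀ u r → proj₁ u ≈ 1# + r * z → _⟨_⟩ᵐ R τ u ≈ℂ 1ℂ)

    -- If there is no such `z`, the zero ideal is the conductor: a nonzero element of an ideal `J`
    -- inside `M` with `τ` trivial on `1 + J` would have a square-zero multiple serving as `z`.
    -- Non-primitivity is a negation, so existence comes out doubly negated.
    nonprimitive⇒squareZero : ¬ IsField R → ∀ τ → ¬ IsPrimitiveᵐ R local τ →
                              ¬ ¬ (∃[ z ] SquareZero-TrivialOn1+ τ z)
    nonprimitive⇒squareZero R-not-field τ τ-not-primitive none =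
      τ-not-primitive (inj₂
        ( τ-nontrivial
        , (λ { (lift x≈0) → resp M (sym x≈0) (0∈ M) })
        , (λ { u (lift z≈0) u≈1+z → τ-one u (trans u≈1+z (trans (+-congˡ z≈0) (+-identityʳ 1#))) })
        , λ J J⊆M τ-trivial {y} y∈J → lift (decidable-stable (y ≟ 0#) λ y≉0 →
            let r , ry≉0 , ry²≈0 = squareZeroMultiple (J⊆M y∈J) y≉0
            in none (r * y , ry≉0 , ry²≈0 , λ u s u≈ → τ-trivial u
                 (*-closed J s (*-closed J r y∈J)) u≈))))
      where
      open GroupHomomorphism τ
      τ-one : ∀ u → proj₁ u ≈ 1# → _⟨_⟩ᵐ R τ u ≈ℂ 1ℂ
      τ-one u u≈1 = ℂR.trans {_⟨_⟩ᵐ R τ u} {_⟨_⟩ᵐ R τ (1ᵘ R)} {1ℂ} (⟦⟧-cong {u} {1ᵘ R} u≈1) ε-homo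

      -- For a trivial `τ` any nonzero nonunit would supply a `z`, so every nonzero element would be
      -- a unit and `R` a field.
      τ-nontrivial : ¬ IsTrivial R τ
      τ-nontrivial τ-trivial = R-not-field
        ( (λ 1≈0 → 1∉M (resp M (sym 1≈0) (0∈ M)))
        , λ x x≉0 → decidable-stable (isUnit? x) λ x∉Rˣ →
            let r , rx≉0 , rx²≈0 = squareZeroMultiple (nonunit⇒∈M x∉Rˣ) x≉0
            in none (r * x , rx≉0 , rx²≈0 , λ u _ _ → τ-trivial u) )

-- Translations by 1 + rz with z² = 0

module SquareZero {c ℓ} (R : CommutativeRing c ℓ) where
  open CommutativeRing R

  module Translation (z : Carrier) (z²≈0 : z * z ≈ 0#) where
    open AbelianGroupProperties +-abelianGroup using (x∙y⁻¹≈ε⇒x≈y)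
    open RingProperties ring using (-‿distribˡ-*; -‿distribʳ-*)
    open NaturalCoefficients commutativeSemiring using (solve; _:=_; _:+_; _:*_; con)
    open SetoidReasoning setoid

    rz-rz≈0 : ∀ r → r * z + - r * z ≈ 0#
    rz-rz≈0 r = trans (+-congˡ (sym (-‿distribˡ-* r z))) (-‿inverseʳ (r * z))

    z[rz]≈0 : ∀ r → z * (r * z) ≈ 0#
    z[rz]≈0 r = begin
      z * (r * z)  ≈⟨ solve 2 (λ z r → z :* (r :* z) := r :* (z :* z)) refl z r ⟩
      r * (z * z)  ≈⟨ *-congˡ z²≈0 ⟩
      r * 0#       ≈⟨ zeroʳ r ⟩
      0#           ∎

    [1+rz][1-rz]≈1 : ∀ r → (1# + r * z) * (1# + - r * z) ≈ 1#
    [1+rz][1-rz]≈1 r = begin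
      (1# + r * z) * (1# + - r * z)
        ≈⟨ solve 3 (λ r s z → (con 1 :+ r :* z) :* (con 1 :+ s :* z) :=
             con 1 :+ ((r :* z :+ s :* z) :+ s :* (z :* (r :* z)))) refl r (- r) z ⟩
      1# + ((r * z + - r * z) + - r * (z * (r * z)))
        ≈⟨ +-congˡ (+-cong (rz-rz≈0 r) (trans (*-congˡ (z[rz]≈0 r)) (zeroʳ (- r)))) ⟩
      1# + (0# + 0#)
        ≈⟨ trans (+-congˡ (+-identityˡ 0#)) (+-identityʳ 1#) ⟩
      1# ∎

    1+_z : Carrier → Unit R
    1+ r z = 1# + r * z , 1# + - r * z , trans (*-comm _ _) ([1+rz][1-rz]≈1 r) , [1+rz][1-rz]≈1 r

    -- Multiplication by `u` clears the inverse and leaves a polynomial relation.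
    z[u-au⁻¹]≈0⇒zu²≈za : ∀ a (u : Unit R) → z * (proj₁ u - a * proj₁ (_⁻¹ᵘ R u)) ≈ 0# →
                         z * (proj₁ u * proj₁ u) ≈ z * a
    z[u-au⁻¹]≈0⇒zu²≈za a (u , u⁻¹ , _ , uu⁻¹≈1) eq = begin
      z * (u * u)          ≈⟨ *-assoc z u u ⟨
      (z * u) * u          ≈⟨ *-congʳ (x∙y⁻¹≈ε⇒x≈y (z * u) (z * (a * u⁻¹)) (begin
          z * u - z * (a * u⁻¹)        ≈⟨ +-congˡ (-‿distribʳ-* z (a * u⁻¹)) ⟩
          z * u + z * - (a * u⁻¹)      ≈⟨ distribˡ z u (- (a * u⁻¹)) ⟨
          z * (u - a * u⁻¹)            ≈⟨ eq ⟩
          0#                           ∎)) ⟩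
      (z * (a * u⁻¹)) * u  ≈⟨ solve 4 (λ z a u v → (z :* (a :* v)) :* u := (z :* a) :* (u :* v)) refl z a u u⁻¹ ⟩
      (z * a) * (u * u⁻¹)  ≈⟨ trans (*-congˡ uu⁻¹≈1) (*-identityʳ (z * a)) ⟩
      z * a                ∎

    -- With E = uv + vw + wu, the hypotheses say zu² = zv² = zw² = za and zE = 0,
    -- so that 0 = zE² = z(u²v² + v²w² + w²u²) + 2z(u²vw + v²uw + w²uv)
    --           = 3za² + 2a·zE = 3za².
    stationary⇒z≈0 : ThreeIsUnit R → (a u v w : Unit R) →
      let a′ = proj₁ a ; _⁻¹ = λ t → proj₁ (_⁻¹ᵘ R t) in
      z * (proj₁ u - a′ * u ⁻¹) ≈ 0# → z * (proj₁ v - a′ * v ⁻¹) ≈ 0# →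
      z * (proj₁ w - a′ * w ⁻¹) ≈ 0# →
      z * (a′ * (u ⁻¹ + (v ⁻¹ + w ⁻¹))) ≈ 0# → z ≈ 0#
    stationary⇒z≈0 (three⁻¹ , _ , 3*3⁻¹≈1)
      a@(a′ , a⁻¹ , _ , aa⁻¹≈1) u@(u′ , u⁻¹ , _ , uu⁻¹≈1) v@(v′ , v⁻¹ , _ , vv⁻¹≈1) w@(w′ , w⁻¹ , _ , ww⁻¹≈1)
      eq-u eq-v eq-w eq-a = begin
        z                                       ≈⟨ *-identityʳ z ⟨
        z * 1#                                  ≈⟨ *-congˡ unit≈1 ⟨
        z * ((three * three⁻¹) * ((a′ * a⁻¹) * (a′ * a⁻¹)))
          ≈⟨ solve 5 (λ z t t⁻¹ a a⁻¹ → z :* ((t :* t⁻¹) :* ((a :* a⁻¹) :* (a :* a⁻¹))) :=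
               (t :* ((z :* a) :* a)) :* (t⁻¹ :* (a⁻¹ :* a⁻¹))) refl z three three⁻¹ a′ a⁻¹ ⟩
        (three * ((z * a′) * a′)) * (three⁻¹ * (a⁻¹ * a⁻¹)) ≈⟨ *-congʳ 3za²≈0 ⟩
        0# * (three⁻¹ * (a⁻¹ * a⁻¹))            ≈⟨ zeroˡ _ ⟩
        0#                                      ∎
      where
      -- This is `3 · 1#` unfolded, trailing zero included, so that `3*3⁻¹≈1` fits as it stands.
      three : Carrier
      three = 1# + (1# + (1# + 0#))

      E : Carrier
      E = u′ * v′ + (v′ * w′ + w′ * u′)

      unit≈1 : (three * three⁻¹) * ((a′ * a⁻¹) * (a′ * a⁻¹)) ≈ 1#
      unit≈1 = trans (*-cong 3*3⁻¹≈1 (trans (*-cong aa⁻¹≈1 aa⁻¹≈1) (*-identityˡ 1#))) (*-identityˡ 1#)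

      zu²≈za = z[u-au⁻¹]≈0⇒zu²≈za a′ u eq-u
      zv²≈za = z[u-au⁻¹]≈0⇒zu²≈za a′ v eq-v
      zw²≈za = z[u-au⁻¹]≈0⇒zu²≈za a′ w eq-w

      zE≈0 : z * E ≈ 0#
      zE≈0 = begin
        z * E
          -- Each product is padded with `a′ * a⁻¹` and with the missing unit times its inverse. The
          -- next step is then an identity in which units and inverses are independent variables.
          ≈⟨ *-congˡ (begin
            u′ * v′ + (v′ * w′ + w′ * u′)
              ≈⟨ +-cong (scale ww⁻¹≈1) (+-cong (scale uu⁻¹≈1) (scale vv⁻¹≈1)) ⟨
            ((a′ * a⁻¹) * (w′ * w⁻¹)) * (u′ * v′) +
              (((a′ * a⁻¹) * (u′ * u⁻¹)) * (v′ * w′) + ((a′ * a⁻¹) * (v′ * v⁻¹)) * (w′ * u′))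
              ∎) ⟩
        z * (((a′ * a⁻¹) * (w′ * w⁻¹)) * (u′ * v′) +
              (((a′ * a⁻¹) * (u′ * u⁻¹)) * (v′ * w′) + ((a′ * a⁻¹) * (v′ * v⁻¹)) * (w′ * u′)))
          ≈⟨ solve 9 (λ z a a⁻¹ u u⁻¹ v v⁻¹ w w⁻¹ →
               z :* (((a :* a⁻¹) :* (w :* w⁻¹)) :* (u :* v) :+
                 (((a :* a⁻¹) :* (u :* u⁻¹)) :* (v :* w) :+ ((a :* a⁻¹) :* (v :* v⁻¹)) :* (w :* u))) :=
               (z :* (a :* (u⁻¹ :+ (v⁻¹ :+ w⁻¹)))) :* (a⁻¹ :* (u :* (v :* w))))
               refl z a′ a⁻¹ u′ u⁻¹ v′ v⁻¹ w′ w⁻¹ ⟩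
        (z * (a′ * (u⁻¹ + (v⁻¹ + w⁻¹)))) * (a⁻¹ * (u′ * (v′ * w′))) ≈⟨ *-congʳ eq-a ⟩
        0# * (a⁻¹ * (u′ * (v′ * w′))) ≈⟨ zeroˡ _ ⟩
        0# ∎
        where
        scale : ∀ {x x⁻¹ y} → x * x⁻¹ ≈ 1# → ((a′ * a⁻¹) * (x * x⁻¹)) * y ≈ y
        scale {y = y} xx⁻¹≈1 = trans
          (*-congʳ (trans (*-cong aa⁻¹≈1 xx⁻¹≈1) (*-identityˡ 1#))) (*-identityˡ y)

      3za²≈0 : three * ((z * a′) * a′) ≈ 0#
      3za²≈0 = begin
        three * ((z * a′) * a′)
          ≈⟨ solve 2 (λ z a → (con 1 :+ (con 1 :+ (con 1 :+ con 0))) :* ((z :* a) :* a) :=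
               (z :* a) :* a :+ ((z :* a) :* a :+ (z :* a) :* a)) refl z a′ ⟩
        (z * a′) * a′ + ((z * a′) * a′ + (z * a′) * a′)
          ≈⟨ +-cong (square zu²≈za zv²≈za) (+-cong (square zv²≈za zw²≈za) (square zw²≈za zu²≈za)) ⟩
        (z * (u′ * u′)) * (v′ * v′) + ((z * (v′ * v′)) * (w′ * w′) + (z * (w′ * w′)) * (u′ * u′))
          ≈⟨ +-identityʳ _ ⟨
        ((z * (u′ * u′)) * (v′ * v′) + ((z * (v′ * v′)) * (w′ * w′) + (z * (w′ * w′)) * (u′ * u′))) + 0#
          ≈⟨ +-congˡ cross ⟨
        ((z * (u′ * u′)) * (v′ * v′) + ((z * (v′ * v′)) * (w′ * w′) + (z * (w′ * w′)) * (u′ * u′))) +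
          (1# + 1#) * ((z * (v′ * v′)) * (u′ * w′) + ((z * (w′ * w′)) * (u′ * v′) + (z * (u′ * u′)) * (v′ * w′)))
          ≈⟨ solve 4 (λ z u v w →
               ((z :* (u :* u)) :* (v :* v) :+ ((z :* (v :* v)) :* (w :* w) :+ (z :* (w :* w)) :* (u :* u))) :+
               (con 1 :+ con 1) :* ((z :* (v :* v)) :* (u :* w) :+
                 ((z :* (w :* w)) :* (u :* v) :+ (z :* (u :* u)) :* (v :* w))) :=
               (z :* (u :* v :+ (v :* w :+ w :* u))) :* (u :* v :+ (v :* w :+ w :* u))) refl z u′ v′ w′ ⟩
        (z * E) * E ≈⟨ *-congʳ zE≈0 ⟩
        0# * E      ≈⟨ zeroˡ E ⟩
        0#          ∎
        where
        square : ∀ {p q} → z * p ≈ z * a′ → z * q ≈ z * a′ → (z * a′) * a′ ≈ (z * p) * q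
        square {p} {q} zp≈za zq≈za = begin
          (z * a′) * a′  ≈⟨ *-congʳ zq≈za ⟨
          (z * q) * a′   ≈⟨ solve 3 (λ z q a → (z :* q) :* a := (z :* a) :* q) refl z q a′ ⟩
          (z * a′) * q   ≈⟨ *-congʳ zp≈za ⟨
          (z * p) * q    ∎

        cross : (1# + 1#) * ((z * (v′ * v′)) * (u′ * w′) +
                  ((z * (w′ * w′)) * (u′ * v′) + (z * (u′ * u′)) * (v′ * w′))) ≈ 0#
        cross = begin
          (1# + 1#) * ((z * (v′ * v′)) * (u′ * w′) +
            ((z * (w′ * w′)) * (u′ * v′) + (z * (u′ * u′)) * (v′ * w′)))
            ≈⟨ *-congˡ (+-cong (*-congʳ zv²≈za) (+-cong (*-congʳ zw²≈za) (*-congʳ zu²≈za))) ⟩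
          (1# + 1#) * ((z * a′) * (u′ * w′) + ((z * a′) * (u′ * v′) + (z * a′) * (v′ * w′)))
            ≈⟨ solve 5 (λ z a u v w →
                 (con 1 :+ con 1) :* ((z :* a) :* (u :* w) :+ ((z :* a) :* (u :* v) :+ (z :* a) :* (v :* w))) :=
                 (z :* (u :* v :+ (v :* w :+ w :* u))) :* ((con 1 :+ con 1) :* a)) refl z a′ u′ v′ w′ ⟩
          (z * E) * ((1# + 1#) * a′) ≈⟨ *-congʳ zE≈0 ⟩
          0# * ((1# + 1#) * a′)      ≈⟨ zeroˡ _ ⟩
          0#                         ∎

-- Sums over the unit group

module UnitSums {c ℓ k kℓ} (R : CommutativeRing c ℓ) (finite : IsFinite R)
                (K : CommutativeRing k kℓ) where
  open IsFinite finite
  open FiniteRing R finite using (element-index)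
  open CommutativeRing K
  open Sum semiring
  open AbelianGroup (unitGroup R) using () renaming (_≈_ to _≈ᵘ_; _∙_ to _·_; _⁻¹ to _⁻¹ᵘ′)
  private module R = CommutativeRing R
  open SetoidReasoning setoid

  -- The counterpart of `extendByZero` over an arbitrary commutative ring `K`; the complex numbers
  -- are substituted only at the end.
  extend : (Unit R → Carrier) → ∀ {x} → Dec (IsUnit R x) → Carrier
  extend f {x} (yes x∈Rˣ) = f (x , x∈Rˣ)
  extend f     (no _)     = 0#

  ∑ᵘ : (Unit R → Carrier) → Carrier
  ∑ᵘ f = sum (λ i → extend f (isUnit? (element i)))

  -- A unit carries an inverse and proofs that `≈ᵘ` ignores, so a function on `Unit R` need not
  -- respect `≈ᵘ`. Reindexing a sum requires that it does.
  Extensional : (Unit R → Carrier) → Set _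
  Extensional f = ∀ u v → u ≈ᵘ v → f u ≈ f v

  extend-cong : ∀ {f g} → (∀ u → f u ≈ g u) → ∀ {x} (d : Dec (IsUnit R x)) → extend f d ≈ extend g d
  extend-cong f≈g (yes x∈Rˣ) = f≈g (_ , x∈Rˣ)
  extend-cong f≈g (no _)     = refl

  ∑ᵘ-cong : ∀ {f g} → (∀ u → f u ≈ g u) → ∑ᵘ f ≈ ∑ᵘ g
  ∑ᵘ-cong f≈g = sum-cong-≋ (λ i → extend-cong f≈g (isUnit? (element i)))

  ∑ᵘ-zero : ∀ {f} → (∀ u → f u ≈ 0#) → ∑ᵘ f ≈ 0#
  ∑ᵘ-zero {f} f≈0 = trans (sum-cong-≋ (λ i → extend-zero (isUnit? (element i)))) (sum-replicate-zero size)
    where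
    extend-zero : ∀ {x} (d : Dec (IsUnit R x)) → extend f d ≈ 0#
    extend-zero (yes x∈Rˣ) = f≈0 (_ , x∈Rˣ)
    extend-zero (no _)     = refl

  *-distribˡ-∑ᵘ : ∀ x f → x * ∑ᵘ f ≈ ∑ᵘ (λ u → x * f u)
  *-distribˡ-∑ᵘ x f = trans
    (*-distribˡ-sum x (λ i → extend f (isUnit? (element i))))
    (sum-cong-≋ (λ i → *-extend (isUnit? (element i))))
    where
    *-extend : ∀ {y} (d : Dec (IsUnit R y)) → x * extend f d ≈ extend (λ u → x * f u) d
    *-extend (yes _) = refl
    *-extend (no _)  = zeroʳ x

  *-distribʳ-∑ᵘ : ∀ x f → ∑ᵘ f * x ≈ ∑ᵘ (λ u → f u * x)
  *-distribʳ-∑ᵘ x f = begin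
    ∑ᵘ f * x             ≈⟨ *-comm (∑ᵘ f) x ⟩
    x * ∑ᵘ f             ≈⟨ *-distribˡ-∑ᵘ x f ⟩
    ∑ᵘ (λ u → x * f u)   ≈⟨ ∑ᵘ-cong (λ u → *-comm x (f u)) ⟩
    ∑ᵘ (λ u → f u * x)   ∎

  ∑ᵘ-sum-comm : ∀ {n} (f : Unit R → Fin n → Carrier) →
                ∑ᵘ (λ u → sum (f u)) ≈ sum (λ j → ∑ᵘ (λ u → f u j))
  ∑ᵘ-sum-comm {n} f = trans
    (sum-cong-≋ (λ i → extend-sum (isUnit? (element i))))
    (∑-comm (λ i j → extend (λ u → f u j) (isUnit? (element i))))
    where
    extend-sum : ∀ {x} (d : Dec (IsUnit R x)) →
                 extend (λ u → sum (f u)) d ≈ sum (λ j → extend (λ u → f u j) d)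
    extend-sum (yes _) = refl
    extend-sum (no _)  = sym (sum-replicate-zero n)

  ∑ᵘ-comm : ∀ (f : Unit R → Unit R → Carrier) → ∑ᵘ (λ u → ∑ᵘ (f u)) ≈ ∑ᵘ (λ v → ∑ᵘ (λ u → f u v))
  ∑ᵘ-comm f = trans
    (∑ᵘ-sum-comm (λ u j → extend (f u) (isUnit? (element j))))
    (sum-cong-≋ (λ j → swap (isUnit? (element j))))
    where
    swap : ∀ {x} (d : Dec (IsUnit R x)) →
           ∑ᵘ (λ u → extend (f u) d) ≈ extend (λ v → ∑ᵘ (λ u → f u v)) d
    swap (yes _) = refl
    swap (no _)  = ∑ᵘ-zero {λ _ → 0#} (λ _ → refl)

  -- Multiplication by `e` permutes the whole of `R`, hence the indices. It preserves units and
  -- nonunits alike, which excludes the mixed cases.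
  ∑ᵘ-translate : ∀ e {f} → Extensional f → ∑ᵘ f ≈ ∑ᵘ (λ u → f (e · u))
  ∑ᵘ-translate e@(x , x⁻¹ , x⁻¹x≈1 , xx⁻¹≈1) {f} f-ext = trans
    (∑-permute _ translation)
    (sum-cong-≋ (λ i → translate (element-index (x R.* element i))
      (isUnit? (element (translation ⟨$⟩ʳ i))) (isUnit? (element i))))
    where
    cancel : ∀ {r s} → s R.* r R.≈ R.1# → ∀ i → index (s R.* element (index (r R.* element i))) ≡ i
    cancel {r} {s} sr≈1 i = ≡.trans
      (Inverse.from-cong enumeration
        (R.trans (R.*-congˡ (element-index (r R.* element i)))
          (R.trans (R.sym (R.*-assoc s r (element i)))
            (R.trans (R.*-congʳ sr≈1) (R.*-identityˡ (element i))))))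
      (Inverse.strictlyInverseʳ enumeration i)

    translation : Permutation′ size
    translation = permutation
      (λ i → index (x R.* element i)) (λ i → index (x⁻¹ R.* element i))
      (cancel xx⁻¹≈1) (cancel x⁻¹x≈1)

    IsUnit-resp : ∀ {r s} → r R.≈ s → IsUnit R r → IsUnit R s
    IsUnit-resp r≈s (r⁻¹ , p , q) =
      r⁻¹ , R.trans (R.*-congˡ (R.sym r≈s)) p , R.trans (R.*-congʳ (R.sym r≈s)) q

    translate : ∀ {y y′} → y′ R.≈ x R.* y → (d′ : Dec (IsUnit R y′)) (d : Dec (IsUnit R y)) →
                extend f d′ ≈ extend (λ u → f (e · u)) d
    translate y′≈xy (yes p) (yes q) = f-ext _ _ y′≈xy
    translate y′≈xy (no ¬p) (yes q) =
      contradiction (IsUnit-resp (R.sym y′≈xy) (proj₂ (e · (_ , q)))) ¬p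
    translate {y} y′≈xy (yes p) (no ¬q) = contradiction (IsUnit-resp
      (R.trans (R.*-congˡ y′≈xy) (R.trans (R.sym (R.*-assoc x⁻¹ x y))
        (R.trans (R.*-congʳ x⁻¹x≈1) (R.*-identityˡ y))))
      (proj₂ ((e ⁻¹ᵘ′) · (_ , p)))) ¬q
    translate y′≈xy (no _)  (no _)  = refl

  ∑ᵘ-cube : ∀ f → ∑ᵘ f * (∑ᵘ f * ∑ᵘ f) ≈ ∑ᵘ (λ u → ∑ᵘ (λ v → ∑ᵘ (λ w → f u * (f v * f w))))
  ∑ᵘ-cube f = begin
    ∑ᵘ f * (∑ᵘ f * ∑ᵘ f)
      ≈⟨ *-distribʳ-∑ᵘ _ f ⟩
    ∑ᵘ (λ u → f u * (∑ᵘ f * ∑ᵘ f))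
      ≈⟨ ∑ᵘ-cong (λ u → *-congˡ (*-distribʳ-∑ᵘ _ f)) ⟩
    ∑ᵘ (λ u → f u * ∑ᵘ (λ v → f v * ∑ᵘ f))
      ≈⟨ ∑ᵘ-cong (λ u → *-congˡ (∑ᵘ-cong λ v → *-distribˡ-∑ᵘ (f v) f)) ⟩
    ∑ᵘ (λ u → f u * ∑ᵘ (λ v → ∑ᵘ (λ w → f v * f w)))
      ≈⟨ ∑ᵘ-cong (λ u → trans (*-distribˡ-∑ᵘ (f u) _) (∑ᵘ-cong λ v → *-distribˡ-∑ᵘ (f u) _)) ⟩
    ∑ᵘ (λ u → ∑ᵘ (λ v → ∑ᵘ (λ w → f u * (f v * f w)))) ∎

  ∑ᵘ-comm₃ : ∀ (f : Unit R → Unit R → Unit R → Unit R → Carrier) →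
             ∑ᵘ (λ a → ∑ᵘ (λ u → ∑ᵘ (λ v → ∑ᵘ (f a u v)))) ≈
             ∑ᵘ (λ u → ∑ᵘ (λ v → ∑ᵘ (λ w → ∑ᵘ (λ a → f a u v w))))
  ∑ᵘ-comm₃ f = trans
    (∑ᵘ-comm (λ a u → ∑ᵘ (λ v → ∑ᵘ (f a u v)))) (∑ᵘ-cong λ u → trans
    (∑ᵘ-comm (λ a v → ∑ᵘ (f a u v))) (∑ᵘ-cong λ v →
    ∑ᵘ-comm (λ a w → f a u v w)))

-- The third moment of Kloosterman sums

module KloostermanSum {c ℓ k kℓ} (R : CommutativeRing c ℓ) (finite : IsFinite R)
                      (K : CommutativeRing k kℓ) where
  open CommutativeRing K
  open RawMonoidDefs +-rawMonoid using () renaming (_×_ to _⊗_)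
  open AbelianGroup (unitGroup R) using ()
    renaming (_≈_ to _≈ᵘ_; _∙_ to _·_; ⁻¹-cong to ⁻¹ᵘ-cong)
  private module R = CommutativeRing R

  -- The argument takes place over any integral domain of characteristic zero in which equality with
  -- zero is stable. Primitivity of `ψ` is stated for principal ideals.
  module ThirdMoment
    (≈0-stable : ∀ x → ¬ ¬ x ≈ 0# → x ≈ 0#)
    (noZeroDivisors : ∀ x y → ¬ x ≈ 0# → x * y ≈ 0# → y ≈ 0#)
    (characteristicZero : ∀ n → ¬ suc n ⊗ 1# ≈ 0#)
    (ψ : R.Carrier → Carrier)
    (ψ-cong : ∀ {x y} → x R.≈ y → ψ x ≈ ψ y)
    (ψ-homo : ∀ x y → ψ (x R.+ y) ≈ ψ x * ψ y)
    (ψ-zero : ψ R.0# ≈ 1#)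
    (ψ-primitive : ∀ y → (∀ r → ψ (r R.* y) ≈ 1#) → y R.≈ R.0#)
    (τ : Unit R → Carrier)
    (τ-cong : ∀ {u v} → u ≈ᵘ v → τ u ≈ τ v)
    (τ-homo : ∀ u v → τ (u · v) ≈ τ u * τ v)
    (z : R.Carrier) (z≉0 : ¬ z R.≈ R.0#) (z²≈0 : z R.* z R.≈ R.0#)
    (τ-trivial : ∀ u r → proj₁ u R.≈ R.1# R.+ r R.* z → τ u ≈ 1#)
    (3∈Rˣ : ThreeIsUnit R)
    where

    open UnitSums R finite K
    open IsFinite finite
    open FiniteRing R finite using (element-index)
    open SquareZero.Translation R z z²≈0
    open Sum semiring
    open SemiringMult semiring using (×-assoc-*; ×-congʳ)
    open RingProperties ring using (-‿distribʳ-*)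
    open AbelianGroupProperties +-abelianGroup using (x∙y⁻¹≈ε⇒x≈y)
    open CommutativeSemigroupProperties *-commutativeSemigroup using (interchange; x∙yz≈y∙xz)
    open SetoidReasoning setoid
    private
      module RP = RingProperties R.ring
      module RS = NaturalCoefficients R.commutativeSemiring
      module RR = SetoidReasoning R.setoid

    infix 8 _⁻¹
    _⁻¹ : Unit R → R.Carrier
    u ⁻¹ = proj₁ (_⁻¹ᵘ R u)

    *-cancelˡ : ∀ {x y z} → ¬ x ≈ 0# → x * y ≈ x * z → y ≈ z
    *-cancelˡ {x} {y} {z} x≉0 xy≈xz = x∙y⁻¹≈ε⇒x≈y y z (noZeroDivisors x (y - z) x≉0 (begin
      x * (y - z)      ≈⟨ distribˡ x y (- z) ⟩
      x * y + x * - z  ≈⟨ +-cong xy≈xz (sym (-‿distribʳ-* x z)) ⟩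
      x * z - x * z    ≈⟨ -‿inverseʳ (x * z) ⟩
      0#               ∎))

    N : Carrier
    N = size ⊗ 1#

    N≉0 : ¬ N ≈ 0#
    -- The index of zero shows that the enumeration is not empty.
    N≉0 = nonempty (index R.0#)
      where
      nonempty : ∀ {n} → Fin n → ¬ n ⊗ 1# ≈ 0#
      nonempty {suc n} _ = characteristicZero n

    sum-const : ∀ x → sum {size} (λ _ → x) ≈ N * x
    sum-const x = begin
      sum {size} (λ _ → x)  ≈⟨ sum-replicate size ⟩
      size ⊗ x              ≈⟨ ×-congʳ size (*-identityˡ x) ⟨
      size ⊗ (1# * x)       ≈⟨ ×-assoc-* size 1# x ⟨
      N * x                 ∎

    -- Orthogonality and stationary phase

    indicator : ∀ {p} {P : Set p} → Dec P → Carrier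
    indicator (yes _) = 1#
    indicator (no _)  = 0#

    δ : R.Carrier → Carrier
    δ x = indicator (x ≟ R.0#)

    δ-cong : ∀ {x y} → x R.≈ y → δ x ≈ δ y
    δ-cong {x} {y} x≈y with x ≟ R.0# | y ≟ R.0#
    ... | yes _   | yes _   = refl
    ... | no  _   | no  _   = refl
    ... | yes x≈0 | no y≉0  = contradiction (R.trans (R.sym x≈y) x≈0) y≉0
    ... | no x≉0  | yes y≈0 = contradiction (R.trans x≈y y≈0) x≉0

    ∑ψ : R.Carrier → Carrier
    ∑ψ y = sum (λ i → ψ (element i R.* y))

    -- The factor translates the summation variable by `r`, which merely permutes the terms.
    ψ-∑ψ : ∀ r y → ψ (r R.* y) * ∑ψ y ≈ ∑ψ y
    ψ-∑ψ r y = begin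
      ψ (r R.* y) * ∑ψ y
        ≈⟨ *-distribˡ-sum (ψ (r R.* y)) (λ i → ψ (element i R.* y)) ⟩
      sum (λ i → ψ (r R.* y) * ψ (element i R.* y))
        ≈⟨ sum-cong-≋ (λ i → begin
          ψ (r R.* y) * ψ (element i R.* y)           ≈⟨ ψ-homo _ _ ⟨
          ψ (r R.* y R.+ element i R.* y)             ≈⟨ ψ-cong (R.distribʳ y r (element i)) ⟨
          ψ ((r R.+ element i) R.* y)                 ≈⟨ ψ-cong (R.*-congʳ (element-index _)) ⟨
          ψ (element (index (r R.+ element i)) R.* y) ∎) ⟩
      sum (λ i → ψ (element (index (r R.+ element i)) R.* y))
        ≈⟨ ∑-permute (λ i → ψ (element i R.* y)) shift ⟨
      ∑ψ y ∎
      where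
      cancel : ∀ {r s} → s R.+ r R.≈ R.0# → ∀ i → index (s R.+ element (index (r R.+ element i))) ≡ i
      cancel {r} {s} s+r≈0 i = ≡.trans
        (Inverse.from-cong enumeration
          (R.trans (R.+-congˡ (element-index (r R.+ element i)))
            (R.trans (R.sym (R.+-assoc s r (element i)))
              (R.trans (R.+-congʳ s+r≈0) (R.+-identityˡ (element i))))))
        (Inverse.strictlyInverseʳ enumeration i)

      shift : Permutation′ size
      shift = permutation
        (λ i → index (r R.+ element i)) (λ i → index (R.- r R.+ element i))
        (cancel (R.-‿inverseʳ r)) (cancel (R.-‿inverseˡ r))

    -- Orthogonality: a nonzero sum could be cancelled from `ψ-∑ψ`, making `ψ` trivial on `Ry`, so
    -- that `y` is zero by primitivity. Stability turns this refutation into an equality.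
    ∑ψ≈Nδ : ∀ y → ∑ψ y ≈ N * δ y
    ∑ψ≈Nδ y with y ≟ R.0#
    ... | yes y≈0 = trans
      (sum-cong-≋ (λ i → trans (ψ-cong (R.trans (R.*-congˡ y≈0) (R.zeroʳ (element i)))) ψ-zero))
      (sum-const 1#)
    ... | no y≉0 = trans
      (≈0-stable (∑ψ y) λ ∑ψ≉0 → y≉0 (ψ-primitive y λ r → *-cancelˡ ∑ψ≉0 (begin
        ∑ψ y * ψ (r R.* y)  ≈⟨ *-comm _ _ ⟩
        ψ (r R.* y) * ∑ψ y  ≈⟨ ψ-∑ψ r y ⟩
        ∑ψ y                ≈⟨ *-identityʳ (∑ψ y) ⟨
        ∑ψ y * 1#           ∎)))
      (sym (zeroʳ N))

    -- The translates are summed over all `r`, whether or not the units `1+ r z` repeat. Hence the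
    -- invariant sum and the orthogonality relation carry the same factor `N`, which cancels.
    stationaryPhase : ∀ (h : Unit R → Carrier) (c : Unit R → R.Carrier) → Extensional h →
      (∀ r u → h (1+ r z · u) ≈ h u * ψ (r R.* (z R.* c u))) →
      ∑ᵘ h ≈ ∑ᵘ (λ u → h u * δ (z R.* c u))
    stationaryPhase h c h-ext h-shift = *-cancelˡ N≉0 (begin
      N * ∑ᵘ h
        ≈⟨ sum-const (∑ᵘ h) ⟨
      sum {size} (λ _ → ∑ᵘ h)
        ≈⟨ sum-cong-≋ (λ i → trans (∑ᵘ-translate (1+ element i z) h-ext)
             (∑ᵘ-cong (h-shift (element i)))) ⟩
      sum (λ i → ∑ᵘ (λ u → h u * ψ (element i R.* (z R.* c u))))
        ≈⟨ ∑ᵘ-sum-comm (λ u i → h u * ψ (element i R.* (z R.* c u))) ⟨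
      ∑ᵘ (λ u → sum (λ i → h u * ψ (element i R.* (z R.* c u))))
        ≈⟨ ∑ᵘ-cong (λ u → begin
          sum (λ i → h u * ψ (element i R.* (z R.* c u)))
            ≈⟨ *-distribˡ-sum (h u) (λ i → ψ (element i R.* (z R.* c u))) ⟨
          h u * ∑ψ (z R.* c u)
            ≈⟨ *-congˡ (∑ψ≈Nδ (z R.* c u)) ⟩
          h u * (N * δ (z R.* c u))
            ≈⟨ x∙yz≈y∙xz (h u) N _ ⟩
          N * (h u * δ (z R.* c u)) ∎) ⟩
      ∑ᵘ (λ u → N * (h u * δ (z R.* c u)))
        ≈⟨ *-distribˡ-∑ᵘ N _ ⟨
      N * ∑ᵘ (λ u → h u * δ (z R.* c u)) ∎)

    -- Summands of the Kloosterman sum under translation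

    κ : R.Carrier → Unit R → Carrier
    κ a u = τ u * ψ (proj₁ u R.+ a R.* u ⁻¹)

    -- The logarithmic derivative of `u + au⁻¹`, that is, `u` times its derivative in `u`.
    phase : R.Carrier → Unit R → R.Carrier
    phase a u = proj₁ u R.- a R.* u ⁻¹

    z-phase : ∀ a u → z R.* phase a u R.≈ z R.* proj₁ u R.- z R.* (a R.* u ⁻¹)
    z-phase a u = R.trans (R.distribˡ z _ _) (R.+-congˡ (R.sym (RP.-‿distribʳ-* z _)))

    κ-ext : ∀ a → Extensional (κ a)
    κ-ext a u v u≈v = *-cong (τ-cong u≈v)
      (ψ-cong (R.+-cong u≈v (R.*-congˡ (⁻¹ᵘ-cong {u} {v} u≈v))))

    -- The inverse of `1 + rz` is exactly `1 - rz`, so the argument of `ψ` is affine in `r`; the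
    -- factor `τ` does not change because it is trivial on `1 + Rz`.
    κ-shift : ∀ a r u → κ a (1+ r z · u) ≈ κ a u * ψ (r R.* (z R.* phase a u))
    κ-shift a r u = begin
      τ (1+ r z · u) * ψ ((R.1# R.+ r R.* z) R.* proj₁ u R.+ a R.* ((R.1# R.+ R.- r R.* z) R.* u ⁻¹))
        ≈⟨ *-cong (trans (τ-homo (1+ r z) u) (trans (*-congʳ (τ-trivial (1+ r z) r R.refl)) (*-identityˡ _)))
             (trans (ψ-cong argument) (ψ-homo _ _)) ⟩
      τ u * (ψ (proj₁ u R.+ a R.* u ⁻¹) * ψ (r R.* (z R.* phase a u)))
        ≈⟨ *-assoc _ _ _ ⟨
      κ a u * ψ (r R.* (z R.* phase a u)) ∎
      where
      argument : (R.1# R.+ r R.* z) R.* proj₁ u R.+ a R.* ((R.1# R.+ R.- r R.* z) R.* u ⁻¹) R.≈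
                 (proj₁ u R.+ a R.* u ⁻¹) R.+ r R.* (z R.* phase a u)
      argument = RR.begin
        (R.1# R.+ r R.* z) R.* proj₁ u R.+ a R.* ((R.1# R.+ R.- r R.* z) R.* u ⁻¹)
          -- The variable `s` stands for `- r`, which makes this an identity of semirings.
          RR.≈⟨ (let open RS in solve 6 (λ r s z u v a →
            (con 1 :+ r :* z) :* u :+ a :* ((con 1 :+ s :* z) :* v) :=
            (u :+ a :* v) :+ (r :* (z :* u) :+ s :* (z :* (a :* v))))
            R.refl r (R.- r) z (proj₁ u) (u ⁻¹) a) ⟩
        (proj₁ u R.+ a R.* u ⁻¹) R.+ (r R.* (z R.* proj₁ u) R.+ R.- r R.* (z R.* (a R.* u ⁻¹)))
          RR.≈⟨ R.+-congˡ (R.+-congˡ (R.trans (R.sym (RP.-‿distribˡ-* r _)) (RP.-‿distribʳ-* r _))) ⟩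
        (proj₁ u R.+ a R.* u ⁻¹) R.+ (r R.* (z R.* proj₁ u) R.+ r R.* (R.- (z R.* (a R.* u ⁻¹))))
          RR.≈⟨ R.+-congˡ (R.distribˡ r _ _) ⟨
        (proj₁ u R.+ a R.* u ⁻¹) R.+ r R.* (z R.* proj₁ u R.- z R.* (a R.* u ⁻¹))
          RR.≈⟨ R.+-congˡ (R.*-congˡ (z-phase a u)) ⟨
        (proj₁ u R.+ a R.* u ⁻¹) R.+ r R.* (z R.* phase a u) RR.∎

    -- The summand cut down to the stationary points. The factor `δ` is retained because it later
    -- supplies the equations for `u`, `v` and `w`.
    κ̂ : R.Carrier → Unit R → Carrier
    κ̂ a u = κ a u * δ (z R.* phase a u)

    κ̂-cong : ∀ {a b} u → a R.≈ b → κ̂ a u ≈ κ̂ b u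
    κ̂-cong u a≈b = *-cong
      (*-congˡ (ψ-cong (R.+-congˡ (R.*-congʳ a≈b))))
      (δ-cong (R.*-congˡ (R.+-congˡ (R.-‿cong (R.*-congʳ a≈b)))))

    -- Multiplying `a` by `1 + rz` changes `phase a u` by a multiple of `z`, which `z` annihilates.
    -- The set of stationary points stays fixed and only `ψ` moves.
    κ̂-shift : ∀ r a u → κ̂ ((R.1# R.+ r R.* z) R.* a) u ≈ κ̂ a u * ψ (r R.* (z R.* (a R.* u ⁻¹)))
    κ̂-shift r a u = begin
      (τ u * ψ (proj₁ u R.+ (R.1# R.+ r R.* z) R.* a R.* u ⁻¹)) *
        δ (z R.* phase ((R.1# R.+ r R.* z) R.* a) u)
        ≈⟨ *-cong (trans (*-congˡ (trans (ψ-cong argument) (ψ-homo _ _))) (sym (*-assoc _ _ _)))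
             (δ-cong stationary) ⟩
      (κ a u * ψ (r R.* (z R.* (a R.* u ⁻¹)))) * δ (z R.* phase a u)
        ≈⟨ trans (*-assoc _ _ _) (trans (*-congˡ (*-comm _ _)) (sym (*-assoc _ _ _))) ⟩
      κ̂ a u * ψ (r R.* (z R.* (a R.* u ⁻¹))) ∎
      where
      open RS using (solve; _:=_; _:+_; _:*_; con)
      argument : proj₁ u R.+ (R.1# R.+ r R.* z) R.* a R.* u ⁻¹ R.≈
                 (proj₁ u R.+ a R.* u ⁻¹) R.+ r R.* (z R.* (a R.* u ⁻¹))
      argument = solve 5 (λ r z a u v → u :+ (con 1 :+ r :* z) :* a :* v :=
        (u :+ a :* v) :+ r :* (z :* (a :* v))) R.refl r z a (proj₁ u) (u ⁻¹)

      stationary : z R.* phase ((R.1# R.+ r R.* z) R.* a) u R.≈ z R.* phase a u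
      stationary = RR.begin
        z R.* (proj₁ u R.- (R.1# R.+ r R.* z) R.* a R.* u ⁻¹)
          RR.≈⟨ z-phase ((R.1# R.+ r R.* z) R.* a) u ⟩
        z R.* proj₁ u R.- z R.* ((R.1# R.+ r R.* z) R.* a R.* u ⁻¹)
          RR.≈⟨ R.+-congˡ (R.-‿cong (solve 4 (λ r z a v → z :* ((con 1 :+ r :* z) :* a :* v) :=
               z :* (a :* v) :+ (z :* (r :* z)) :* (a :* v)) R.refl r z a (u ⁻¹))) ⟩
        z R.* proj₁ u R.- (z R.* (a R.* u ⁻¹) R.+ (z R.* (r R.* z)) R.* (a R.* u ⁻¹))
          RR.≈⟨ R.+-congˡ (R.-‿cong (R.trans
               (R.+-congˡ (R.trans (R.*-congʳ (z[rz]≈0 r)) (R.zeroˡ _))) (R.+-identityʳ _))) ⟩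
        z R.* proj₁ u R.- z R.* (a R.* u ⁻¹)
          RR.≈⟨ z-phase a u ⟨
        z R.* phase a u RR.∎

    -- Vanishing of the sum of cubes

    summand : Unit R → Unit R → Unit R → Unit R → Carrier
    summand a u v w = κ̂ (proj₁ a) u * (κ̂ (proj₁ a) v * κ̂ (proj₁ a) w)

    summand-shift : ∀ u v w r a → summand (1+ r z · a) u v w ≈
      summand a u v w * ψ (r R.* (z R.* (proj₁ a R.* (u ⁻¹ R.+ (v ⁻¹ R.+ w ⁻¹)))))
    summand-shift u v w r a = begin
      summand (1+ r z · a) u v w
        ≈⟨ *-cong (κ̂-shift r a′ u) (*-cong (κ̂-shift r a′ v) (κ̂-shift r a′ w)) ⟩
      (κ̂ a′ u * ψ p) * ((κ̂ a′ v * ψ q) * (κ̂ a′ w * ψ s))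
        ≈⟨ *-congˡ (interchange _ _ _ _) ⟩
      (κ̂ a′ u * ψ p) * ((κ̂ a′ v * κ̂ a′ w) * (ψ q * ψ s))
        ≈⟨ interchange _ _ _ _ ⟩
      summand a u v w * (ψ p * (ψ q * ψ s))
        ≈⟨ *-congˡ (trans (ψ-homo p (q R.+ s)) (*-congˡ (ψ-homo q s))) ⟨
      summand a u v w * ψ (p R.+ (q R.+ s))
        ≈⟨ *-congˡ (ψ-cong (let open RS in solve 6 (λ r z a u v w →
             r :* (z :* (a :* u)) :+ (r :* (z :* (a :* v)) :+ r :* (z :* (a :* w))) :=
             r :* (z :* (a :* (u :+ (v :+ w))))) R.refl r z a′ (u ⁻¹) (v ⁻¹) (w ⁻¹))) ⟩
      summand a u v w * ψ (r R.* (z R.* (a′ R.* (u ⁻¹ R.+ (v ⁻¹ R.+ w ⁻¹))))) ∎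
      where
      a′ p q s : R.Carrier
      a′ = proj₁ a
      p = r R.* (z R.* (a′ R.* u ⁻¹))
      q = r R.* (z R.* (a′ R.* v ⁻¹))
      s = r R.* (z R.* (a′ R.* w ⁻¹))

    -- A product with four indicator factors: if all four equations held, `z` would be zero, so at
    -- least one factor vanishes.
    summand*δ≈0 : ∀ u v w a →
      summand a u v w * δ (z R.* (proj₁ a R.* (u ⁻¹ R.+ (v ⁻¹ R.+ w ⁻¹)))) ≈ 0#
    summand*δ≈0 u v w a
      with z R.* phase (proj₁ a) u ≟ R.0# | z R.* phase (proj₁ a) v ≟ R.0# | z R.* phase (proj₁ a) w ≟ R.0#
         | z R.* (proj₁ a R.* (u ⁻¹ R.+ (v ⁻¹ R.+ w ⁻¹))) ≟ R.0#
    ... | yes eq-u | yes eq-v | yes eq-w | yes eq-a =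
      contradiction (stationary⇒z≈0 3∈Rˣ a u v w eq-u eq-v eq-w eq-a) z≉0
    ... | no _ | _ | _ | _ = trans (*-congʳ (trans (*-congʳ (zeroʳ _)) (zeroˡ _))) (zeroˡ _)
    ... | yes _ | no _ | _ | _ =
      trans (*-congʳ (trans (*-congˡ (trans (*-congʳ (zeroʳ _)) (zeroˡ _))) (zeroʳ _))) (zeroˡ _)
    ... | yes _ | yes _ | no _ | _ =
      trans (*-congʳ (trans (*-congˡ (trans (*-congˡ (zeroʳ _)) (zeroʳ _))) (zeroʳ _))) (zeroˡ _)
    ... | yes _ | yes _ | yes _ | no _ = zeroʳ _

    thirdMoment≈0 : ∀ {f g : Unit R → Carrier} → (∀ a → g a ≈ ∑ᵘ (κ (proj₁ a))) →
                    (∀ a → f a ≈ g a * (g a * g a)) → ∑ᵘ f ≈ 0#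
    thirdMoment≈0 {f} {g} g≈∑κ f≈g³ = begin
      ∑ᵘ f
        ≈⟨ ∑ᵘ-cong (λ a → trans (f≈g³ a) (*-cong (restrict a) (*-cong (restrict a) (restrict a)))) ⟩
      ∑ᵘ (λ a → ∑ᵘ (κ̂ (proj₁ a)) * (∑ᵘ (κ̂ (proj₁ a)) * ∑ᵘ (κ̂ (proj₁ a))))
        ≈⟨ ∑ᵘ-cong (λ a → ∑ᵘ-cube (κ̂ (proj₁ a))) ⟩
      ∑ᵘ (λ a → ∑ᵘ (λ u → ∑ᵘ (λ v → ∑ᵘ (summand a u v))))
        ≈⟨ ∑ᵘ-comm₃ summand ⟩
      ∑ᵘ (λ u → ∑ᵘ (λ v → ∑ᵘ (λ w → ∑ᵘ (λ a → summand a u v w))))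
        -- With `a` innermost, stationary phase applies a second time, now in `a` for fixed `u`,
        -- `v`, `w`.
        ≈⟨ ∑ᵘ-zero (λ u → ∑ᵘ-zero λ v → ∑ᵘ-zero λ w → trans
             (stationaryPhase (λ a → summand a u v w) (λ a → proj₁ a R.* (u ⁻¹ R.+ (v ⁻¹ R.+ w ⁻¹)))
               (λ a b a≈b → *-cong (κ̂-cong u a≈b) (*-cong (κ̂-cong v a≈b) (κ̂-cong w a≈b)))
               (summand-shift u v w))
             (∑ᵘ-zero (summand*δ≈0 u v w))) ⟩
      0# ∎
      where
      restrict : ∀ a → g a ≈ ∑ᵘ (κ̂ (proj₁ a))
      restrict a = trans (g≈∑κ a)
        (stationaryPhase (κ (proj₁ a)) (phase (proj₁ a)) (κ-ext (proj₁ a)) (κ-shift (proj₁ a)))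

mainTheorem4 : ∀ {c ℓ : Level} (R : CommutativeRing c ℓ) (finite : IsFinite R) (local : IsLocal R) →
    IsFrobenius R →
    ¬ IsField R →
    HasOddCharacteristic (residueField R local) →
    ThreeIsUnit R →
    (ψ : AdditiveCharacter R) → IsPrimitiveᵃ R ψ →
    (τ : MultiplicativeCharacter R) → ¬ IsPrimitiveᵐ R local τ →
    ∑ˣ R finite (λ a → kloosterman R finite ψ τ (proj₁ a) ^ℂ 3) ≈ℂ 0ℂ
mainTheorem4 {c} {ℓ} R finite local _ R-not-field _ 3∈Rˣ ψ ψ-primitive τ τ-not-primitive =
  -- The goal is stable, so the doubly negated existence of `z` suffices.
  ComplexField.≈0-stable total λ total≉0 →
    nonprimitive⇒squareZero R-not-field τ τ-not-primitive λ where
      (z , z≉0 , z²≈0 , τ-trivial) → total≉0 (vanishes z z≉0 z²≈0 τ-trivial)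
  where
  open CommutativeRing R
  open IsFinite finite using (element; isUnit?)
  open FiniteRing.Local R finite local using (nonprimitive⇒squareZero)
  open UnitSums R finite ℂ-commutativeRing using (extend; ∑ᵘ)
  open Sum ℂR.semiring using (sum-cong-≋)
  module ψ = GroupHomomorphism ψ
  module τ = GroupHomomorphism τ

  K : Unit R → ℂ
  K a = kloosterman R finite ψ τ (proj₁ a)

  total : ℂ
  total = ∑ˣ R finite (λ a → K a ^ℂ 3)

  ^3≈cube : ∀ x → x ^ℂ 3 ≈ℂ x *ℂ (x *ℂ x)
  ^3≈cube x = ℂR.*-congˡ {x} {x *ℂ (x *ℂ 1ℂ)} {x *ℂ x}
    (ℂR.*-congˡ {x} {x *ℂ 1ℂ} {x} (ℂR.*-identityʳ x))

  extendByZero≈extend : ∀ f {x} (d : Dec (IsUnit R x)) → extendByZero R f d ≈ℂ extend f d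
  extendByZero≈extend f {x} (yes x∈Rˣ) = ℂR.refl {f (x , x∈Rˣ)}
  extendByZero≈extend f     (no _)     = ℂR.refl {0ℂ}

  ∑ˣ≈∑ᵘ : ∀ f → ∑ˣ R finite f ≈ℂ ∑ᵘ f
  ∑ˣ≈∑ᵘ f = sum-cong-≋
    {x = λ i → extendByZero R f (isUnit? (element i))}
    {y = λ i → extend f (isUnit? (element i))}
    (λ i → extendByZero≈extend f (isUnit? (element i)))

  -- Primitivity, applied to the principal ideal `Ry`.
  trivialMultiples⇒≈0 : ∀ y → (∀ r → _⟨_⟩ᵃ R ψ (r * y) ≈ℂ 1ℂ) → y ≈ 0#
  trivialMultiples⇒≈0 y ψ-trivial = lower (proj₁
    (ψ-primitive ⟨y⟩ (λ { {x} (r , x≈ry) →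
      ℂR.trans {_⟨_⟩ᵃ R ψ x} {_⟨_⟩ᵃ R ψ (r * y)} {1ℂ} (ψ.⟦⟧-cong x≈ry) (ψ-trivial r) }))
    (1# , sym (*-identityˡ y)))
    where
    ⟨y⟩ : Ideal R
    ⟨y⟩ = record
      { members  = λ x → ∃[ r ] x ≈ r * y
      ; resp     = λ { x≈x′ (r , x≈ry) → r , trans (sym x≈x′) x≈ry }
      ; 0∈       = 0# , sym (zeroˡ y)
      ; +-closed = λ { (r , x≈ry) (s , x′≈sy) → r + s , trans (+-cong x≈ry x′≈sy) (sym (distribʳ y r s)) }
      ; *-closed = λ { t (r , x≈ry) → t * r , trans (*-congˡ x≈ry) (sym (*-assoc t r y)) }
      }

  vanishes : ∀ z → ¬ z ≈ 0# → z * z ≈ 0# →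
             (∀ u r → proj₁ u ≈ 1# + r * z → _⟨_⟩ᵐ R τ u ≈ℂ 1ℂ) → total ≈ℂ 0ℂ
  vanishes z z≉0 z²≈0 τ-trivial = ℂR.trans {total} {∑ᵘ (λ a → K a ^ℂ 3)} {0ℂ}
    (∑ˣ≈∑ᵘ (λ a → K a ^ℂ 3))
    (thirdMoment≈0 {λ a → K a ^ℂ 3} {K}
      (λ a → ∑ˣ≈∑ᵘ (λ u → _⟨_⟩ᵐ R τ u *ℂ _⟨_⟩ᵃ R ψ (proj₁ u + proj₁ a * proj₁ (_⁻¹ᵘ R u))))
      (λ a → ^3≈cube (K a)))
    where
    open KloostermanSum.ThirdMoment R finite ℂ-commutativeRing
      ComplexField.≈0-stable ComplexField.noZeroDivisors ComplexField.characteristicZero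
      (_⟨_⟩ᵃ R ψ) ψ.⟦⟧-cong ψ.homo ψ.ε-homo trivialMultiples⇒≈0
      (_⟨_⟩ᵐ R τ) (λ {u} {v} → τ.⟦⟧-cong {u} {v}) τ.homo
      z z≉0 z²≈0 τ-trivial 3∈Rˣ
      using (thirdMoment≈0)
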